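{- Let $k\ge 1$ and let $S$ be a Viterbi sequence of length $k(mk+1)$ for $k$-state Markov chains, where $m$ is a positive integer. Then $S$ can be rearranged to have a periodic interior lasting for at least $m+1$ periods; that is, there are an integer $1\le p\le k$, distinct states $c_0,\dots,c_{p-1}$, and a sequence $S'$ equivalent to $S$, such that $S'$ contains a contiguous block of at least $(m+1)p$ transitions that goes around the cycle $c_0\to c_1\to\cdots\to c_{p-1}\to c_0$ (i.e. at least $m+1$ full consecutive traversals of the cycle).
   Context: A $k$-state Markov chain has states $0,1,\dots,k-1$, an initial distribution $(\pi_i)$ and a stochastic transition matrix $(p_{ij})$. The space $\mathcal M_k$ of all such chains is a product of $k+1$ simplices of dimension $k-1$, and carries Lebesgue measure. A sequence of length $n$ is a sequence of states $s_0s_1\cdots s_n$ (with $n$ transitions); its probability is $\Pr[s_0\cdots s_n]=\pi_{s_0}\prod_{t=1}^n p_{s_{t-1}s_t}$. A Viterbi path of length $n$ of a Markov chain is a sequence of length $n$ of maximal probability. Two Markov chains are in the same region (for given $n$) iff they have the same set of Viterbi paths of length $n$; a Viterbi region is a region of positive measure in $\mathcal M_k$. A Viterbi sequence of length $n$ is a sequence that is a Viterbi path for (the chains of) some Viterbi region. Two sequences of the same length are equivalent if they have the same initial state and the same multiset of transitions $(s_{t-1},s_t)$; to rearrange a sequence means to replace it by an equivalent one. -}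

module Defs where

open import Data.Fin.Base as Fin using (Fin; toℕ; fromℕ<)
open import Data.List.Base as List using (List; []; _∷_)
open import Data.List.Relation.Binary.Permutation.Propositional using (_↭_)
open import Data.Maybe.Base using (Maybe; maybe′)
open import Data.Maybe.Relation.Unary.Any using (Any)
open import Data.Nat.Base as ℕ using (ℕ; suc; pred; NonZero)
import Data.Nat.Properties as ℕ
open import Data.Nat.DivMod using (_mod_)
open import Data.Product.Base using (Σ; ∃-syntax; _×_; _,_)
open import Data.Rational.Base as ℚ using (ℚ; 0ℚ; 1ℚ; ½; ∣_∣; Positive; NonNegative; positive)
import Data.Rational.Properties as ℚ
open import Data.Rational.Solver using (module +-*-Solver)
open import Data.Vec.Base using (Vec; []; _∷_; head; lookup)
import Data.Vec.Functional as Vector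
open import Function.Bundles using (_⇔_)
open import Function.Definitions using (Injective)
open import Relation.Binary.PropositionalEquality using (_≡_; refl; sym; trans; cong; subst)
open import Relation.Nullary.Negation.Core using (¬_)

------------------------------------------------------------------------
-- Real numbers: rational Cauchy sequences, compared by _≈ℝ_.

record ℝ : Set where
  field
    seq    : ℕ → ℚ
    cauchy : ∀ ε → 0ℚ ℚ.< ε →
             ∃[ N ] ∀ m n → N ℕ.≤ m → N ℕ.≤ n → ∣ seq m ℚ.- seq n ∣ ℚ.≤ ε

open ℝ public

infix  4 _≤ℝ_ _≈ℝ_
infixl 6 _+ℝ_
infixl 7 _*ℝ_

_≤ℝ_ : ℝ → ℝ → Set
x ≤ℝ y = ∀ ε → 0ℚ ℚ.< ε → ∃[ N ] ∀ n → N ℕ.≤ n → seq x n ℚ.≤ seq y n ℚ.+ ε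

_≈ℝ_ : ℝ → ℝ → Set
x ≈ℝ y = x ≤ℝ y × y ≤ℝ x

fromℚ : ℚ → ℝ
fromℚ q .seq _ = q
fromℚ q .cauchy ε 0<ε = 0 , λ _ _ _ _ →
  subst (ℚ._≤ ε) (sym (cong ∣_∣ (ℚ.+-inverseʳ q))) (ℚ.<⇒≤ 0<ε)

0ℝ 1ℝ : ℝ
0ℝ = fromℚ 0ℚ
1ℝ = fromℚ 1ℚ

private
  half-pos : ∀ ε → 0ℚ ℚ.< ε → 0ℚ ℚ.< ε ℚ.* ½
  half-pos ε 0<ε = ℚ.positive⁻¹ (ε ℚ.* ½) {{ℚ.pos*pos⇒pos ε {{positive 0<ε}} ½}}

  half+half : ∀ ε → ε ℚ.* ½ ℚ.+ ε ℚ.* ½ ≡ ε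
  half+half ε = trans (sym (ℚ.*-distribˡ-+ ε ½ ½)) (ℚ.*-identityʳ ε)

_+ℝ_ : ℝ → ℝ → ℝ
(x +ℝ y) .seq n = seq x n ℚ.+ seq y n
(x +ℝ y) .cauchy ε 0<ε
  with cauchy x (ε ℚ.* ½) (half-pos ε 0<ε) | cauchy y (ε ℚ.* ½) (half-pos ε 0<ε)
... | N₁ , p₁ | N₂ , p₂ = N₁ ℕ.⊔ N₂ , λ m n N≤m N≤n → begin
  ∣ (seq x m ℚ.+ seq y m) ℚ.- (seq x n ℚ.+ seq y n) ∣
    ≡⟨ cong ∣_∣ (rearrange (seq x m) (seq y m) (seq x n) (seq y n)) ⟩
  ∣ (seq x m ℚ.- seq x n) ℚ.+ (seq y m ℚ.- seq y n) ∣
    ≤⟨ ℚ.∣p+q∣≤∣p∣+∣q∣ (seq x m ℚ.- seq x n) (seq y m ℚ.- seq y n) ⟩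
  ∣ seq x m ℚ.- seq x n ∣ ℚ.+ ∣ seq y m ℚ.- seq y n ∣
    ≤⟨ ℚ.+-mono-≤ (p₁ m n (ℕ.m⊔n≤o⇒m≤o N₁ N₂ N≤m) (ℕ.m⊔n≤o⇒m≤o N₁ N₂ N≤n))
                  (p₂ m n (ℕ.m⊔n≤o⇒n≤o N₁ N₂ N≤m) (ℕ.m⊔n≤o⇒n≤o N₁ N₂ N≤n)) ⟩
  ε ℚ.* ½ ℚ.+ ε ℚ.* ½
    ≡⟨ half+half ε ⟩
  ε ∎
  where
  open ℚ.≤-Reasoning
  rearrange : ∀ a b c d → (a ℚ.+ b) ℚ.- (c ℚ.+ d) ≡ (a ℚ.- c) ℚ.+ (b ℚ.- d)
  rearrange = solve 4 (λ a b c d → (a :+ b) :- (c :+ d) := (a :- c) :+ (b :- d)) refl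
    where open +-*-Solver

private
  eventually-bounded : ∀ x → ∃[ K ] NonNegative K × ∃[ N ] ∀ n → N ℕ.≤ n → ∣ seq x n ∣ ℚ.≤ K
  eventually-bounded x with cauchy x 1ℚ (ℚ.positive⁻¹ 1ℚ)
  ... | N , p = 1ℚ ℚ.+ ∣ seq x N ∣
              , ℚ.nonNeg+nonNeg⇒nonNeg 1ℚ ∣ seq x N ∣ {{ℚ.∣-∣-nonNeg (seq x N)}}
              , N , λ n N≤n → begin
    ∣ seq x n ∣
      ≡⟨ cong ∣_∣ (split (seq x n) (seq x N)) ⟩
    ∣ (seq x n ℚ.- seq x N) ℚ.+ seq x N ∣
      ≤⟨ ℚ.∣p+q∣≤∣p∣+∣q∣ (seq x n ℚ.- seq x N) (seq x N) ⟩
    ∣ seq x n ℚ.- seq x N ∣ ℚ.+ ∣ seq x N ∣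
      ≤⟨ ℚ.+-monoˡ-≤ ∣ seq x N ∣ (p n N N≤n ℕ.≤-refl) ⟩
    1ℚ ℚ.+ ∣ seq x N ∣ ∎
    where
    open ℚ.≤-Reasoning
    split : ∀ a b → a ≡ (a ℚ.- b) ℚ.+ b
    split = solve 2 (λ a b → a := (a :- b) :+ b) refl
      where open +-*-Solver

  *-mono-∣∣ : ∀ {a b K δ} → NonNegative K → ∣ a ∣ ℚ.≤ K → ∣ b ∣ ℚ.≤ δ → ∣ a ℚ.* b ∣ ℚ.≤ K ℚ.* δ
  *-mono-∣∣ {a} {b} {K} {δ} K≥0 a≤K b≤δ = begin
    ∣ a ℚ.* b ∣      ≡⟨ ℚ.∣p*q∣≡∣p∣*∣q∣ a b ⟩
    ∣ a ∣ ℚ.* ∣ b ∣  ≤⟨ ℚ.*-monoʳ-≤-nonNeg ∣ b ∣ {{ℚ.∣-∣-nonNeg b}} a≤K ⟩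
    K ℚ.* ∣ b ∣      ≤⟨ ℚ.*-monoˡ-≤-nonNeg K {{K≥0}} b≤δ ⟩
    K ℚ.* δ          ∎
    where open ℚ.≤-Reasoning

  shrink : ∀ K → NonNegative K → ∀ ε → 0ℚ ℚ.< ε → ∃[ δ ] 0ℚ ℚ.< δ × K ℚ.* δ ℚ.≤ ε
  shrink K K≥0 ε 0<ε = δ , ℚ.positive⁻¹ δ {{δ>0}} , (begin
    K ℚ.* δ                ≤⟨ ℚ.*-monoʳ-≤-nonNeg δ {{ℚ.pos⇒nonNeg δ {{δ>0}}}} K≤L ⟩
    L ℚ.* (ε ℚ.* 1/L)      ≡⟨ rearrange L ε 1/L ⟩
    ε ℚ.* (L ℚ.* 1/L)      ≡⟨ cong (ε ℚ.*_) (ℚ.*-inverseʳ L {{ℚ.pos⇒nonZero L {{L>0}}}}) ⟩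
    ε ℚ.* 1ℚ               ≡⟨ ℚ.*-identityʳ ε ⟩
    ε                      ∎)
    where
    open ℚ.≤-Reasoning
    L : ℚ
    L = K ℚ.+ 1ℚ
    L>0 : Positive L
    L>0 = ℚ.nonNeg+pos⇒pos K {{K≥0}} 1ℚ
    1/L δ : ℚ
    1/L = (ℚ.1/ L) {{ℚ.pos⇒nonZero L {{L>0}}}}
    δ = ε ℚ.* 1/L
    δ>0 : Positive δ
    δ>0 = ℚ.pos*pos⇒pos ε {{positive 0<ε}} 1/L {{ℚ.1/pos⇒pos L {{L>0}}}}
    K≤L : K ℚ.≤ L
    K≤L = subst (ℚ._≤ L) (ℚ.+-identityʳ K) (ℚ.+-monoʳ-≤ K (ℚ.nonNegative⁻¹ 1ℚ))
    rearrange : ∀ a b c → a ℚ.* (b ℚ.* c) ≡ b ℚ.* (a ℚ.* c)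
    rearrange = solve 3 (λ a b c → a :* (b :* c) := b :* (a :* c)) refl
      where open +-*-Solver

  product-close : ∀ a b c d {K L δ η ε} → NonNegative K → NonNegative L →
                  ∣ a ∣ ℚ.≤ K → ∣ d ∣ ℚ.≤ L → ∣ b ℚ.- d ∣ ℚ.≤ δ → ∣ a ℚ.- c ∣ ℚ.≤ η →
                  K ℚ.* δ ℚ.≤ ε ℚ.* ½ → L ℚ.* η ℚ.≤ ε ℚ.* ½ →
                  ∣ a ℚ.* b ℚ.- c ℚ.* d ∣ ℚ.≤ ε
  product-close a b c d {K} {L} {δ} {η} {ε} K≥0 L≥0 a≤K d≤L b-d≤δ a-c≤η Kδ≤ Lη≤ = begin
    ∣ a ℚ.* b ℚ.- c ℚ.* d ∣
      ≡⟨ cong ∣_∣ (rearrange a b c d) ⟩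
    ∣ a ℚ.* (b ℚ.- d) ℚ.+ d ℚ.* (a ℚ.- c) ∣
      ≤⟨ ℚ.∣p+q∣≤∣p∣+∣q∣ (a ℚ.* (b ℚ.- d)) (d ℚ.* (a ℚ.- c)) ⟩
    ∣ a ℚ.* (b ℚ.- d) ∣ ℚ.+ ∣ d ℚ.* (a ℚ.- c) ∣
      ≤⟨ ℚ.+-mono-≤ (*-mono-∣∣ {a} {b ℚ.- d} {K} {δ} K≥0 a≤K b-d≤δ)
                    (*-mono-∣∣ {d} {a ℚ.- c} {L} {η} L≥0 d≤L a-c≤η) ⟩
    K ℚ.* δ ℚ.+ L ℚ.* η
      ≤⟨ ℚ.+-mono-≤ {K ℚ.* δ} {ε ℚ.* ½} {L ℚ.* η} {ε ℚ.* ½} Kδ≤ Lη≤ ⟩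
    ε ℚ.* ½ ℚ.+ ε ℚ.* ½
      ≡⟨ half+half ε ⟩
    ε ∎
    where
    open ℚ.≤-Reasoning
    rearrange : ∀ a b c d → a ℚ.* b ℚ.- c ℚ.* d ≡ a ℚ.* (b ℚ.- d) ℚ.+ d ℚ.* (a ℚ.- c)
    rearrange = solve 4 (λ a b c d → a :* b :- c :* d := a :* (b :- d) :+ d :* (a :- c)) refl
      where open +-*-Solver

_*ℝ_ : ℝ → ℝ → ℝ
(x *ℝ y) .seq n = seq x n ℚ.* seq y n
(x *ℝ y) .cauchy ε 0<ε =
  let K , K≥0 , B₁ , b₁ = eventually-bounded x
      L , L≥0 , B₂ , b₂ = eventually-bounded y
      δ , 0<δ , Kδ≤     = shrink K K≥0 (ε ℚ.* ½) (half-pos ε 0<ε)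
      η , 0<η , Lη≤     = shrink L L≥0 (ε ℚ.* ½) (half-pos ε 0<ε)
      N₁ , p₁           = cauchy y δ 0<δ
      N₂ , p₂           = cauchy x η 0<η
  in (B₁ ℕ.⊔ B₂) ℕ.⊔ (N₁ ℕ.⊔ N₂) , λ m n N≤m N≤n →
  let B≤m = ℕ.m⊔n≤o⇒m≤o (B₁ ℕ.⊔ B₂) (N₁ ℕ.⊔ N₂) N≤m
      B≤n = ℕ.m⊔n≤o⇒m≤o (B₁ ℕ.⊔ B₂) (N₁ ℕ.⊔ N₂) N≤n
      M≤m = ℕ.m⊔n≤o⇒n≤o (B₁ ℕ.⊔ B₂) (N₁ ℕ.⊔ N₂) N≤m
      M≤n = ℕ.m⊔n≤o⇒n≤o (B₁ ℕ.⊔ B₂) (N₁ ℕ.⊔ N₂) N≤n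
  in product-close (seq x m) (seq y m) (seq x n) (seq y n) {K} {L} {δ} {η} {ε} K≥0 L≥0
       (b₁ m (ℕ.m⊔n≤o⇒m≤o B₁ B₂ B≤m))
       (b₂ n (ℕ.m⊔n≤o⇒n≤o B₁ B₂ B≤n))
       (p₁ m n (ℕ.m⊔n≤o⇒m≤o N₁ N₂ M≤m) (ℕ.m⊔n≤o⇒m≤o N₁ N₂ M≤n))
       (p₂ m n (ℕ.m⊔n≤o⇒n≤o N₁ N₂ M≤m) (ℕ.m⊔n≤o⇒n≤o N₁ N₂ M≤n))
       Kδ≤ Lη≤

------------------------------------------------------------------------
-- Markov chains and sequences of states

record Distribution (k : ℕ) : Set where
  field
    prob        : Fin k → ℝ
    nonNegative : ∀ i → 0ℝ ≤ℝ prob i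
    sums-to-1   : Vector.foldr _+ℝ_ 0ℝ prob ≈ℝ 1ℝ

open Distribution public using (prob)

record Chain (k : ℕ) : Set where
  field
    initial    : Distribution k
    transition : Fin k → Distribution k

open Chain public

-- s₀ s₁ ⋯ sₙ: the length n counts transitions, not states.
Sequence : ℕ → ℕ → Set
Sequence k n = Vec (Fin k) (suc n)

transitions : ∀ {k n} → Sequence k n → List (Fin k × Fin k)
transitions (_ ∷ [])    = []
transitions (i ∷ j ∷ s) = (i , j) ∷ transitions (j ∷ s)

Pr[_] : ∀ {k n} → Chain k → Sequence k n → ℝ
Pr[ M ] s = prob (initial M) (head s) *ℝ
            List.foldr (λ (i , j) r → prob (transition M i) j *ℝ r) 1ℝ (transitions s)

IsViterbiPath : ∀ {k n} → Chain k → Sequence k n → Set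
IsViterbiPath {k} {n} M s = ∀ (t : Sequence k n) → Pr[ M ] t ≤ℝ Pr[ M ] s

SameRegion : ∀ {k} → ℕ → Chain k → Chain k → Set
SameRegion {k} n M M′ = ∀ (s : Sequence k n) → IsViterbiPath M s ⇔ IsViterbiPath M′ s

------------------------------------------------------------------------
-- Lebesgue measure on the space of k-state chains.
--
-- Each of the k + 1 simplices is parametrised by its coordinates at the
-- states other than 0 (the remaining one being 1 minus their sum); up to a
-- constant factor this identifies its Lebesgue measure with that of ℝ^(k-1).

free : ∀ {k} → Fin (pred k) → Fin k
free {suc _} = Fin.suc

-- Row 0 is the initial distribution, row i + 1 the transitions out of i.
coordinate : ∀ {k} → Chain k → Fin (suc k) → Fin (pred k) → ℝ
coordinate M Fin.zero    j = prob (initial M) (free j)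
coordinate M (Fin.suc i) j = prob (transition M i) (free j)

record Interval : Set where
  field
    lo hi : ℚ
    lo≤hi : lo ℚ.≤ hi

  width : ℚ
  width = hi ℚ.- lo

open Interval public

Box : ℕ → Set
Box k = Fin (suc k) → Fin (pred k) → Interval

volume : ∀ {k} → Box k → ℚ
volume B = ∏ λ r → ∏ λ j → width (B r j)
  where
  ∏ : ∀ {n} → (Fin n → ℚ) → ℚ
  ∏ = Vector.foldr ℚ._*_ 1ℚ

_∈Box_ : ∀ {k} → Chain k → Box k → Set
M ∈Box B = ∀ r j → fromℚ (lo (B r j)) ≤ℝ coordinate M r j
                 × coordinate M r j ≤ℝ fromℚ (hi (B r j))

-- `nothing` is the empty box; it is needed because for k = 1 the space has
-- dimension 0, where every genuine box is a point of volume 1.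
BoxSequence : ℕ → Set
BoxSequence k = ℕ → Maybe (Box k)

Covers : ∀ {k} → BoxSequence k → (Chain k → Set) → Set
Covers c A = ∀ M → A M → ∃[ n ] Any (M ∈Box_) (c n)

TotalVolume≤ : ∀ {k} → BoxSequence k → ℚ → Set
TotalVolume≤ c ε =
  ∀ N → Vector.foldr ℚ._+_ 0ℚ {N} (λ i → maybe′ volume 0ℚ (c (toℕ i))) ℚ.≤ ε

-- Lebesgue outer measure (the infimum of the total volumes of countable box
-- covers) is positive.  Regions are semialgebraic, hence measurable, so for
-- them it is Lebesgue measure.
PositiveMeasure : ∀ {k} → (Chain k → Set) → Set
PositiveMeasure {k} A =
  ∃[ ε ] 0ℚ ℚ.< ε × (∀ (c : BoxSequence k) → Covers c A → ¬ TotalVolume≤ c ε)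

-- A Viterbi region is represented by any chain M in it.
IsViterbiSequence : ∀ {k n} → Sequence k n → Set
IsViterbiSequence {k} {n} s =
  Σ (Chain k) λ M → PositiveMeasure (SameRegion n M) × IsViterbiPath M s

------------------------------------------------------------------------
-- Rearrangement and periodic interiors

Equivalent : ∀ {k n} → Sequence k n → Sequence k n → Set
Equivalent s t = head s ≡ head t × transitions s ↭ transitions t

-- The block s_start, …, s_(start + len) runs around the cycle, starting
-- (without loss of generality, by rotating the cycle) at c₀.
record PeriodicInterior {k n : ℕ} (periods : ℕ) (s : Sequence k n) : Set where
  field
    p            : ℕ
    {{p≢0}}      : NonZero p
    p≤k          : p ℕ.≤ k
    cycle        : Fin p → Fin k
    distinct     : Injective _≡_ _≡_ cycle
    start len    : ℕ
    long-enough  : periods ℕ.* p ℕ.≤ len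
    fits         : start ℕ.+ len ℕ.≤ n
    runs-around  : ∀ i → i ℕ.≤ len → (in-range : start ℕ.+ i ℕ.< suc n) →
                   lookup s (fromℕ< in-range) ≡ cycle (i mod p)

{-# OPTIONS --safe #-}

-- Cut S into mk + 1 blocks of k transitions.  Each block repeats a state, so
-- it contains a contiguous simple cycle, and m + 1 of these mk + 1 cycles have
-- the same length.  If two of them, C and D, use the same edges, then C can be
-- moved to where D is without changing the multiset of transitions; so it
-- suffices to see that cycles of equal length in a Viterbi sequence always use
-- the same edges.
--
-- Writing Pr S = G c d, where c and d are the products over the edges of C
-- missing from D and of D missing from C, the sequences with C doubled and D
-- deleted, or vice versa, have probabilities G c² and G d².  They are at most
-- Pr S, hence G (c - d)² ≤ 0; and G ≥ Pr S is bounded below because some path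
-- follows only transitions of probability about 1/k.  So c = d throughout the
-- region of S.  The equation c = d defines a null set: every row contains at
-- most one edge of either product, so there is a direction in the space of
-- chains along which every factor of c increases and every factor of d
-- decreases.  On each line of points of a fine grid in this direction c - d
-- changes sign once, and one box around that point covers all solutions close
-- to the line.  With mesh h in dimension n this takes O(h^(1-n)) boxes of
-- volume O(h^n).

module Submission where

open import Defs
open import Data.Nat.Base using (ℕ; _+_; _*_; _≤_)
open import Data.Product.Base using (∃-syntax; _×_)

open import Algebra.Bundles using (CommutativeRing)
open import Data.Bool.Base using (Bool; true; false; if_then_else_)
open import Data.Empty using (⊥; ⊥-elim)
open import Data.Fin.Base as Fin using (Fin; zero; suc; toℕ; fromℕ<)
import Data.Fin.Properties as Fin
open import Data.Integer.Base as ℤ using (+_)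
import Data.Integer.Properties as ℤ
open import Data.List.Base as List using (List; []; _∷_; _++_; length)
import Data.List.Properties as List
open import Data.List.Membership.Propositional using (_∈_; _∉_)
open import Data.List.Membership.Propositional.Properties using (∈-filter⁺; ∈-filter⁻)
open import Data.List.Membership.Propositional.Properties.WithK using (unique∧set⇒bag)
import Data.List.Membership.DecPropositional as DecMembership
open import Data.List.Relation.Binary.BagAndSetEquality using (∼bag⇒↭)
open import Data.List.Relation.Binary.Permutation.Propositional as Perm using (_↭_; ↭-refl; ↭-sym; ↭-trans; ↭-reflexive)
import Data.List.Relation.Binary.Permutation.Propositional.Properties as Perm
open import Data.List.Relation.Unary.All as All using (All; []; _∷_)
import Data.List.Relation.Unary.All.Properties as All
open import Data.List.Relation.Unary.AllPairs as AllPairs using ([]; _∷_)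
import Data.List.Relation.Unary.AllPairs.Properties as AllPairs
open import Data.List.Relation.Unary.Any using (here; there; any?)
open import Data.List.Relation.Unary.Unique.Propositional using (Unique)
import Data.List.Relation.Unary.Unique.Propositional.Properties as Unique
open import Data.Maybe.Base using (Maybe; just; nothing; maybe′)
open import Data.Maybe.Relation.Unary.Any as Maybe using (just)
open import Data.Nat.Base as ℕ using (zero; suc; NonZero)
import Data.Nat.Properties as ℕ
open import Data.Nat.DivMod using (_%_; _mod_; m<n⇒m%n≡m; [m+n]%n≡m%n; m%n<n)
open import Data.Product.Base using (Σ-syntax; _,_; proj₁; proj₂)
import Data.Product.Properties as Product
open import Data.Rational.Base as ℚ using (ℚ; 0ℚ; 1ℚ; ½; ∣_∣)
import Data.Rational.Properties as ℚ
open import Data.Rational.Solver using (module +-*-Solver)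
import Data.Rational.Unnormalised.Base as ℚᵘ
import Data.Rational.Unnormalised.Properties as ℚᵘ
open import Data.Sum.Base using (_⊎_; inj₁; inj₂)
open import Data.Vec.Base as Vec using (Vec; []; _∷_; head; tabulate; lookup; _[_]≔_)
import Data.Vec.Properties as Vec
open import Data.Vec.Functional as Vector using (insertAt; removeAt)
open import Data.Vec.Functional.Properties using (insertAt-removeAt)
open import Function.Base using (_∘_)
open import Function.Bundles using (mk⇔; Equivalence)
open import Relation.Binary.PropositionalEquality hiding ([_])
open import Relation.Nullary.Decidable using (Dec; yes; no; does; ¬?; dec-true; dec-false)
open import Relation.Nullary.Negation.Core using (¬_)

open import Algebra.Properties.CommutativeMonoid.Sum ℚ.+-0-commutativeMonoid using (sum; ∑-distrib-+; sum-cong-≗)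
open import Algebra.Properties.Semiring.Sum (CommutativeRing.semiring ℚ.+-*-commutativeRing) using (*-distribʳ-sum)
open import Algebra.Properties.CommutativeSemiring.Exp (CommutativeRing.commutativeSemiring ℚ.+-*-commutativeRing) using (_^_; ^-distrib-*; ^-assocʳ)

-- Inequalities between rational numbers

*-monoˡ-≤ : ∀ {a b c} → 0ℚ ℚ.≤ a → b ℚ.≤ c → a ℚ.* b ℚ.≤ a ℚ.* c
*-monoˡ-≤ {a} 0≤a = ℚ.*-monoˡ-≤-nonNeg a {{ℚ.nonNegative 0≤a}}

0≤* : ∀ {a b} → 0ℚ ℚ.≤ a → 0ℚ ℚ.≤ b → 0ℚ ℚ.≤ a ℚ.* b
0≤* {a} {b} 0≤a 0≤b = ℚ.nonNegative⁻¹ (a ℚ.* b)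
  {{ℚ.nonNeg*nonNeg⇒nonNeg a {{ℚ.nonNegative 0≤a}} b {{ℚ.nonNegative 0≤b}}}}

0<* : ∀ {a b} → 0ℚ ℚ.< a → 0ℚ ℚ.< b → 0ℚ ℚ.< a ℚ.* b
0<* {a} {b} 0<a 0<b = ℚ.positive⁻¹ (a ℚ.* b)
  {{ℚ.pos*pos⇒pos a {{ℚ.positive 0<a}} b {{ℚ.positive 0<b}}}}

0≤1 : 0ℚ ℚ.≤ 1ℚ
0≤1 = ℚ.nonNegative⁻¹ 1ℚ

0<1 : 0ℚ ℚ.< 1ℚ
0<1 = ℚ.positive⁻¹ 1ℚ

0<½ : 0ℚ ℚ.< ½
0<½ = ℚ.positive⁻¹ ½

-- The identity says `x - y = a - b`. In this form an estimate splits into known inequalities, added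
-- up to `a ≤ b`, and an identity for the ring solver.
≤-from : ∀ {a b} x y → a ℚ.≤ b → x ℚ.+ b ≡ y ℚ.+ a → x ℚ.≤ y
≤-from {a} {b} x y a≤b eq = begin
  x                    ≡⟨ solve 2 (λ x b → x := (x :+ b) :+ :- b) refl x b ⟩
  (x ℚ.+ b) ℚ.+ ℚ.- b  ≡⟨ cong (ℚ._+ ℚ.- b) eq ⟩
  (y ℚ.+ a) ℚ.+ ℚ.- b  ≤⟨ ℚ.+-monoˡ-≤ (ℚ.- b) (ℚ.+-monoʳ-≤ y a≤b) ⟩
  (y ℚ.+ b) ℚ.+ ℚ.- b  ≡⟨ solve 2 (λ x b → (x :+ b) :+ :- b := x) refl y b ⟩
  y                    ∎
  where open ℚ.≤-Reasoning ; open +-*-Solver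

≤-∣∣ : ∀ p → p ℚ.≤ ∣ p ∣
≤-∣∣ p with ℚ.≤-total 0ℚ p
... | inj₁ 0≤p = ℚ.≤-reflexive (sym (ℚ.0≤p⇒∣p∣≡p 0≤p))
... | inj₂ p≤0 = ℚ.≤-trans p≤0 (ℚ.0≤∣p∣ p)

halves : ∀ ε → ε ℚ.* ½ ℚ.+ ε ℚ.* ½ ≡ ε
halves ε = trans (sym (ℚ.*-distribˡ-+ ε ½ ½)) (ℚ.*-identityʳ ε)

reciprocal : ∀ {a} → 0ℚ ℚ.< a → ∃[ b ] 0ℚ ℚ.< b × a ℚ.* b ≡ 1ℚ
reciprocal {a} 0<a = b , ℚ.positive⁻¹ b {{ℚ.1/pos⇒pos a {{p}}}} , ℚ.*-inverseʳ a {{ℚ.pos⇒nonZero a {{p}}}}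
  where
  p : ℚ.Positive a
  p = ℚ.positive 0<a
  b : ℚ
  b = (ℚ.1/ a) {{ℚ.pos⇒nonZero a {{p}}}}

-- The witness is `ε / (K + 1)`; the added 1 keeps the denominator positive when `K` is 0.
scale-below : ∀ {K ε} → 0ℚ ℚ.≤ K → 0ℚ ℚ.< ε → ∃[ δ ] 0ℚ ℚ.< δ × K ℚ.* δ ℚ.≤ ε
scale-below {K} {ε} 0≤K 0<ε =
  let r , 0<r , inv = reciprocal (ℚ.+-mono-≤-< 0≤K 0<1)
  in ε ℚ.* r , 0<* 0<ε 0<r , ≤-from _ _ (0≤* (ℚ.<⇒≤ 0<ε) (ℚ.<⇒≤ 0<r)) (begin
    K ℚ.* (ε ℚ.* r) ℚ.+ ε ℚ.* r ≡⟨ solve 3 (λ K e r → K :* (e :* r) :+ e :* r := e :* ((K :+ con 1ℚ) :* r)) refl K ε r ⟩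
    ε ℚ.* ((K ℚ.+ 1ℚ) ℚ.* r)    ≡⟨ cong (ε ℚ.*_) inv ⟩
    ε ℚ.* 1ℚ                    ≡⟨ solve 1 (λ e → e :* con 1ℚ := e :+ con 0ℚ) refl ε ⟩
    ε ℚ.+ 0ℚ                    ∎)
  where open ≡-Reasoning ; open +-*-Solver

-- The ordered ring of real numbers

-- Comparing the underlying sequences keeps the Cauchy proofs out of unification.
infix 4 _≤ˢ_ _⊑_

record _≤ˢ_ (x y : ℕ → ℚ) : Set where
  constructor ≤ˢ-intro
  field ≤ˢ-elim : ∀ ε → 0ℚ ℚ.< ε → ∃[ N ] ∀ n → N ℕ.≤ n → x n ℚ.≤ y n ℚ.+ ε

open _≤ˢ_

_⊑_ : ℝ → ℝ → Set
x ⊑ y = seq x ≤ˢ seq y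

≤ˢ-trans : ∀ {x y z} → x ≤ˢ y → y ≤ˢ z → x ≤ˢ z
≤ˢ-trans {x} {y} {z} (≤ˢ-intro x≤y) (≤ˢ-intro y≤z) = ≤ˢ-intro λ ε 0<ε →
  let N , p  = x≤y (ε ℚ.* ½) (0<* 0<ε 0<½)
      N′ , q = y≤z (ε ℚ.* ½) (0<* 0<ε 0<½)
  in N ℕ.⊔ N′ , λ n N≤n → begin
  x n                               ≤⟨ p n (ℕ.m⊔n≤o⇒m≤o N N′ N≤n) ⟩
  y n ℚ.+ ε ℚ.* ½                   ≤⟨ ℚ.+-monoˡ-≤ _ (q n (ℕ.m⊔n≤o⇒n≤o N N′ N≤n)) ⟩
  z n ℚ.+ ε ℚ.* ½ ℚ.+ ε ℚ.* ½       ≡⟨ ℚ.+-assoc (z n) _ _ ⟩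
  z n ℚ.+ (ε ℚ.* ½ ℚ.+ ε ℚ.* ½)     ≡⟨ cong (z n ℚ.+_) (halves ε) ⟩
  z n ℚ.+ ε                         ∎
  where open ℚ.≤-Reasoning

≤ˢ-pointwise : ∀ {x y} → (∀ n → x n ℚ.≤ y n) → x ≤ˢ y
≤ˢ-pointwise {x} {y} le = ≤ˢ-intro λ ε 0<ε → 0 , λ n _ → ℚ.≤-trans (le n)
  (subst (ℚ._≤ y n ℚ.+ ε) (ℚ.+-identityʳ (y n)) (ℚ.+-monoʳ-≤ (y n) (ℚ.<⇒≤ 0<ε)))

≤ˢ-reflexive : ∀ {x y} → x ≗ y → x ≤ˢ y
≤ˢ-reflexive eq = ≤ˢ-pointwise (λ n → ℚ.≤-reflexive (eq n))

≤ˢ-refl : ∀ {x} → x ≤ˢ x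
≤ˢ-refl = ≤ˢ-reflexive (λ _ → refl)

≤ˢ-from : ∀ {a b x y} → a ≤ˢ b → (∀ n → x n ℚ.+ b n ≡ y n ℚ.+ a n) → x ≤ˢ y
≤ˢ-from {a} {b} {x} {y} (≤ˢ-intro a≤b) eq = ≤ˢ-intro λ ε 0<ε → let N , p = a≤b ε 0<ε in
  N , λ n N≤n → ≤-from _ _ (p n N≤n) (begin
  x n ℚ.+ (b n ℚ.+ ε)  ≡⟨ ℚ.+-assoc (x n) _ _ ⟨
  x n ℚ.+ b n ℚ.+ ε    ≡⟨ cong (ℚ._+ ε) (eq n) ⟩
  y n ℚ.+ a n ℚ.+ ε    ≡⟨ solve 3 (λ y a e → y :+ a :+ e := y :+ e :+ a) refl (y n) (a n) ε ⟩
  y n ℚ.+ ε ℚ.+ a n    ∎)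
  where open ≡-Reasoning ; open +-*-Solver

≤ˢ-+-mono : ∀ {a b c d} → a ≤ˢ b → c ≤ˢ d → (λ n → a n ℚ.+ c n) ≤ˢ (λ n → b n ℚ.+ d n)
≤ˢ-+-mono {a} {b} {c} {d} (≤ˢ-intro a≤b) (≤ˢ-intro c≤d) = ≤ˢ-intro λ ε 0<ε →
  let N , p  = a≤b (ε ℚ.* ½) (0<* 0<ε 0<½)
      N′ , q = c≤d (ε ℚ.* ½) (0<* 0<ε 0<½)
  in N ℕ.⊔ N′ , λ n N≤n → ≤-from _ _
  (ℚ.+-mono-≤ (p n (ℕ.m⊔n≤o⇒m≤o N N′ N≤n)) (q n (ℕ.m⊔n≤o⇒n≤o N N′ N≤n)))
  (trans (solve 5 (λ a b c d e → (a :+ c) :+ ((b :+ e) :+ (d :+ e)) := (b :+ d) :+ (e :+ e) :+ (a :+ c)) refl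
            (a n) (b n) (c n) (d n) (ε ℚ.* ½))
         (cong (λ e → b n ℚ.+ d n ℚ.+ e ℚ.+ (a n ℚ.+ c n)) (halves ε)))
  where open +-*-Solver

fromℚ-mono : ∀ {a b} → a ℚ.≤ b → fromℚ a ⊑ fromℚ b
fromℚ-mono a≤b = ≤ˢ-pointwise (λ _ → a≤b)

fromℚ-cancel : ∀ {a b} → fromℚ a ⊑ fromℚ b → a ℚ.≤ b
fromℚ-cancel {a} {b} (≤ˢ-intro a≤b) with a ℚ.≤? b
... | yes p = p
... | no ¬p with ℚ.<-dense (ℚ.≰⇒> ¬p)
-- With the tolerance `c - b` the hypothesis gives `a ≤ c`, against `c < a`.
...   | c , b<c , c<a with a≤b (c ℚ.- b) (subst (ℚ._< c ℚ.- b) (ℚ.+-inverseʳ b) (ℚ.+-monoˡ-< (ℚ.- b) b<c))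
...     | N , q = ⊥-elim (ℚ.<-irrefl refl (ℚ.≤-<-trans (q N ℕ.≤-refl)
                    (subst (ℚ._< a) (solve 2 (λ b c → c := b :+ (c :- b)) refl b c) c<a)))
  where open +-*-Solver

infix 8 -ℝ_

-ℝ_ : ℝ → ℝ
-ℝ x = fromℚ (ℚ.- 1ℚ) *ℝ x

eventually-≤ : ∀ x → ∃[ K ] 0ℚ ℚ.≤ K × ∃[ N ] ∀ n → N ℕ.≤ n → seq x n ℚ.≤ K
eventually-≤ x with cauchy x 1ℚ 0<1
... | N , p = 1ℚ ℚ.+ ∣ seq x N ∣ , ℚ.+-mono-≤ 0≤1 (ℚ.0≤∣p∣ (seq x N)) , N , λ n N≤n → ≤-from _ _
  (ℚ.+-mono-≤ (ℚ.≤-trans (≤-∣∣ _) (p n N N≤n ℕ.≤-refl)) (≤-∣∣ (seq x N)))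
  (solve 3 (λ a b c → a :+ (con 1ℚ :+ c) := con 1ℚ :+ c :+ ((a :- b) :+ b)) refl (seq x n) (seq x N) ∣ seq x N ∣)
  where open +-*-Solver

-- (a + η)(c - b + δ) ≥ 0 gives ab ≤ ac + (a + η)δ + η(c - b).
*ℝ-monoˡ : ∀ a b c → 0ℝ ⊑ a → b ⊑ c → a *ℝ b ⊑ a *ℝ c
*ℝ-monoˡ a b c (≤ˢ-intro 0≤a) (≤ˢ-intro b≤c) = ≤ˢ-intro λ ε 0<ε →
  let 0<ε/2             = 0<* 0<ε 0<½
      L , 0≤L , N₁ , p₁ = eventually-≤ (c +ℝ -ℝ b)
      η , 0<η , Lη≤     = scale-below 0≤L 0<ε/2
      K , 0≤K , N₂ , p₂ = eventually-≤ (a +ℝ fromℚ η)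
      δ , 0<δ , Kδ≤     = scale-below 0≤K 0<ε/2
      N₃ , p₃           = 0≤a η 0<η
      N₄ , p₄           = b≤c δ 0<δ
  in (N₁ ℕ.⊔ N₂) ℕ.⊔ (N₃ ℕ.⊔ N₄) , λ n N≤n →
  let N₁₂≤n = ℕ.m⊔n≤o⇒m≤o (N₁ ℕ.⊔ N₂) (N₃ ℕ.⊔ N₄) N≤n
      N₃₄≤n = ℕ.m⊔n≤o⇒n≤o (N₁ ℕ.⊔ N₂) (N₃ ℕ.⊔ N₄) N≤n
  in bound ε (seq a n) (seq b n) (seq c n)
       (ℚ.<⇒≤ 0<η) (ℚ.<⇒≤ 0<δ) Lη≤ Kδ≤
       (p₁ n (ℕ.m⊔n≤o⇒m≤o N₁ N₂ N₁₂≤n)) (p₂ n (ℕ.m⊔n≤o⇒n≤o N₁ N₂ N₁₂≤n))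
       (p₃ n (ℕ.m⊔n≤o⇒m≤o N₃ N₄ N₃₄≤n)) (p₄ n (ℕ.m⊔n≤o⇒n≤o N₃ N₄ N₃₄≤n))
  where
  open +-*-Solver
  bound : ∀ {L η K δ} ε a b c → 0ℚ ℚ.≤ η → 0ℚ ℚ.≤ δ →
          L ℚ.* η ℚ.≤ ε ℚ.* ½ → K ℚ.* δ ℚ.≤ ε ℚ.* ½ →
          c ℚ.+ ℚ.- 1ℚ ℚ.* b ℚ.≤ L → a ℚ.+ η ℚ.≤ K →
          0ℚ ℚ.≤ a ℚ.+ η → b ℚ.≤ c ℚ.+ δ → a ℚ.* b ℚ.≤ a ℚ.* c ℚ.+ ε
  bound {L} {η} {K} {δ} ε a b c 0≤η 0≤δ Lη≤ Kδ≤ c-b≤L a+η≤K 0≤a+η b≤c+δ = ≤-from _ _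
    (ℚ.+-mono-≤ (*-monoˡ-≤ 0≤a+η b≤c+δ)
    (ℚ.+-mono-≤ (ℚ.≤-trans (*-monoˡ-≤ 0≤η c-b≤L) (ℚ.≤-trans (ℚ.≤-reflexive (ℚ.*-comm η L)) Lη≤))
                (ℚ.≤-trans (*-monoˡ-≤ 0≤δ a+η≤K) (ℚ.≤-trans (ℚ.≤-reflexive (ℚ.*-comm δ K)) Kδ≤))))
    (trans (solve 6 (λ a b c η δ e →
              a :* b :+ ((a :+ η) :* (c :+ δ) :+ (e :+ e))
              := a :* c :+ (e :+ e) :+ ((a :+ η) :* b :+ (η :* (c :+ con (ℚ.- 1ℚ) :* b) :+ δ :* (a :+ η))))
              refl a b c η δ (ε ℚ.* ½))
           (cong (λ e → a ℚ.* c ℚ.+ e ℚ.+ ((a ℚ.+ η) ℚ.* b ℚ.+ (η ℚ.* (c ℚ.+ ℚ.- 1ℚ ℚ.* b) ℚ.+ δ ℚ.* (a ℚ.+ η))))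
                 (halves ε)))

*ℝ-monoʳ : ∀ a b c → 0ℝ ⊑ c → a ⊑ b → a *ℝ c ⊑ b *ℝ c
*ℝ-monoʳ a b c 0≤c a≤b = ≤ˢ-from (*ℝ-monoˡ c a b 0≤c a≤b)
  (λ n → solve 3 (λ a b c → a :* c :+ c :* b := b :* c :+ c :* a) refl (seq a n) (seq b n) (seq c n))
  where open +-*-Solver

*ℝ-mono : ∀ a b c d → 0ℝ ⊑ a → 0ℝ ⊑ d → a ⊑ b → c ⊑ d → a *ℝ c ⊑ b *ℝ d
*ℝ-mono a b c d 0≤a 0≤d a≤b c≤d = ≤ˢ-trans (*ℝ-monoˡ a c d 0≤a c≤d) (*ℝ-monoʳ a b d 0≤d a≤b)

0⊑* : ∀ a b → 0ℝ ⊑ a → 0ℝ ⊑ b → 0ℝ ⊑ a *ℝ b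
0⊑* a b 0≤a 0≤b = ≤ˢ-from (*ℝ-monoˡ a 0ℝ b 0≤a 0≤b)
  (λ n → solve 2 (λ a b → con 0ℚ :+ a :* b := a :* b :+ a :* con 0ℚ) refl (seq a n) (seq b n))
  where open +-*-Solver

-- A constructive substitute for the totality of the order, which is undecidable on Cauchy
-- sequences. One late term of `x` is compared with a rational `c` strictly between `a` and `b`;
-- later terms differ from it by less than the room left on either side of `c`.
cotransitive : ∀ {a b} → a ℚ.< b → ∀ x → x ⊑ fromℚ b ⊎ fromℚ a ⊑ x
cotransitive {a} {b} a<b x
  with ℚ.<-dense a<b
... | c , a<c , c<b with ℚ.<-dense a<c | ℚ.<-dense c<b
...   | a′ , a<a′ , a′<c | b′ , c<b′ , b′<b
  with cauchy x (b ℚ.- b′) (gap b′<b) | cauchy x (a′ ℚ.- a) (gap a<a′)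
  where
  gap : ∀ {p q} → p ℚ.< q → 0ℚ ℚ.< q ℚ.- p
  gap {p} {q} p<q = subst (ℚ._< q ℚ.- p) (ℚ.+-inverseʳ p) (ℚ.+-monoˡ-< (ℚ.- p) p<q)
... | N₁ , p₁ | N₂ , p₂ with ℚ.≤-total (seq x (N₁ ℕ.⊔ N₂)) c
...   | inj₁ le = inj₁ (≤ˢ-intro λ ε 0<ε → N₁ ℕ.⊔ N₂ , λ n N≤n → ≤-from _ _
          (ℚ.+-mono-≤ (ℚ.+-mono-≤ (ℚ.<⇒≤ 0<ε) (ℚ.≤-trans le (ℚ.<⇒≤ c<b′)))
            (ℚ.≤-trans (≤-∣∣ _) (p₁ n (N₁ ℕ.⊔ N₂) (ℕ.m⊔n≤o⇒m≤o N₁ N₂ N≤n) (ℕ.m≤m⊔n N₁ N₂))))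
          (solve 5 (λ x y b b′ e → x :+ ((e :+ b′) :+ (b :- b′)) := b :+ e :+ ((con 0ℚ :+ y) :+ (x :- y))) refl
            (seq x n) (seq x (N₁ ℕ.⊔ N₂)) b b′ ε))
  where open +-*-Solver
...   | inj₂ le = inj₂ (≤ˢ-intro λ ε 0<ε → N₁ ℕ.⊔ N₂ , λ n N≤n → ≤-from _ _
          (ℚ.+-mono-≤ (ℚ.+-mono-≤ (ℚ.<⇒≤ 0<ε) (ℚ.≤-trans (ℚ.<⇒≤ a′<c) le))
            (ℚ.≤-trans (≤-∣∣ _) (p₂ (N₁ ℕ.⊔ N₂) n (ℕ.m≤n⊔m N₁ N₂) (ℕ.m⊔n≤o⇒n≤o N₁ N₂ N≤n))))
          (solve 5 (λ x y a a′ e → a :+ ((e :+ y) :+ (a′ :- a)) := x :+ e :+ ((con 0ℚ :+ a′) :+ (y :- x))) refl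
            (seq x n) (seq x (N₁ ℕ.⊔ N₂)) a a′ ε))
  where open +-*-Solver

-- Natural numbers and powers in ℚ

ν : ℕ → ℚ
ν zero    = 0ℚ
ν (suc n) = 1ℚ ℚ.+ ν n

0≤ν : ∀ n → 0ℚ ℚ.≤ ν n
0≤ν zero    = ℚ.≤-refl
0≤ν (suc n) = ℚ.+-mono-≤ 0≤1 (0≤ν n)

0<ν : ∀ n → 0ℚ ℚ.< ν (suc n)
0<ν n = ℚ.+-mono-<-≤ 0<1 (0≤ν n)

ν-mono : ∀ {m n} → m ℕ.≤ n → ν m ℚ.≤ ν n
ν-mono {n = n} ℕ.z≤n = 0≤ν n
ν-mono (ℕ.s≤s p) = ℚ.+-monoʳ-≤ 1ℚ (ν-mono p)

ν-+ : ∀ m n → ν (m ℕ.+ n) ≡ ν m ℚ.+ ν n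
ν-+ zero    n = sym (ℚ.+-identityˡ (ν n))
ν-+ (suc m) n = trans (cong (1ℚ ℚ.+_) (ν-+ m n)) (sym (ℚ.+-assoc 1ℚ (ν m) (ν n)))

ν-* : ∀ m n → ν (m ℕ.* n) ≡ ν m ℚ.* ν n
ν-* zero    n = sym (ℚ.*-zeroˡ (ν n))
ν-* (suc m) n = begin
  ν (n ℕ.+ m ℕ.* n)            ≡⟨ ν-+ n (m ℕ.* n) ⟩
  ν n ℚ.+ ν (m ℕ.* n)          ≡⟨ cong (ν n ℚ.+_) (ν-* m n) ⟩
  ν n ℚ.+ ν m ℚ.* ν n          ≡⟨ solve 2 (λ a b → b :+ a :* b := (con 1ℚ :+ a) :* b) refl (ν m) (ν n) ⟩
  (1ℚ ℚ.+ ν m) ℚ.* ν n         ∎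
  where open ≡-Reasoning ; open +-*-Solver

ν-^ : ∀ m n → ν (m ℕ.^ n) ≡ ν m ^ n
ν-^ m zero    = ℚ.+-identityʳ 1ℚ
ν-^ m (suc n) = trans (ν-* m (m ℕ.^ n)) (cong (ν m ℚ.*_) (ν-^ m n))

toℚᵘ-ν : ∀ n → ℚ.toℚᵘ (ν n) ℚᵘ.≃ ℚᵘ.mkℚᵘ (+ n) 0
toℚᵘ-ν zero    = ℚᵘ.≃-refl
toℚᵘ-ν (suc n) = ℚᵘ.≃-trans (ℚ.toℚᵘ-homo-+ 1ℚ (ν n))
  (ℚᵘ.≃-trans (ℚᵘ.+-congʳ ℚᵘ.1ℚᵘ (toℚᵘ-ν n)) (ℚᵘ.*≡* (cong (λ z → (+ 1 ℤ.+ z) ℤ.* + 1) (ℤ.*-identityʳ (+ n)))))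

-- The denominator is at least 1, so the absolute value of the numerator is a bound.
archimedean : ∀ q → ∃[ n ] q ℚ.≤ ν n
archimedean q@(ℚ.mkℚ _ _ _) = n , ℚ.toℚᵘ-cancel-≤ (ℚᵘ.≤-respʳ-≃ (ℚᵘ.≃-sym (toℚᵘ-ν n)) (ℚᵘ.*≤* (begin
  ℚ.↥ q ℤ.* + 1            ≡⟨ ℤ.*-identityʳ (ℚ.↥ q) ⟩
  ℚ.↥ q                    ≤⟨ i≤∣i∣ (ℚ.↥ q) ⟩
  + n                      ≤⟨ ℤ.+≤+ (ℕ.m≤m*n n (ℚ.↧ₙ q)) ⟩
  + (n ℕ.* ℚ.↧ₙ q)         ≡⟨ ℤ.pos-* n (ℚ.↧ₙ q) ⟩
  + n ℤ.* ℚ.↧ q            ∎)))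
  where
  open ℤ.≤-Reasoning
  n = ℤ.∣ ℚ.↥ q ∣
  i≤∣i∣ : ∀ i → i ℤ.≤ + ℤ.∣ i ∣
  i≤∣i∣ (+ n)        = ℤ.≤-refl
  i≤∣i∣ (ℤ.-[1+ n ]) = ℤ.-≤+

0≤^ : ∀ {x} n → 0ℚ ℚ.≤ x → 0ℚ ℚ.≤ x ^ n
0≤^ zero    0≤x = 0≤1
0≤^ (suc n) 0≤x = 0≤* 0≤x (0≤^ n 0≤x)

0<^ : ∀ {x} n → 0ℚ ℚ.< x → 0ℚ ℚ.< x ^ n
0<^ zero    0<x = 0<1
0<^ (suc n) 0<x = 0<* 0<x (0<^ n 0<x)

^-mono-≤ : ∀ {x y} n → 0ℚ ℚ.≤ x → x ℚ.≤ y → x ^ n ℚ.≤ y ^ n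
^-mono-≤ zero    0≤x x≤y = ℚ.≤-refl
^-mono-≤ {x} {y} (suc n) 0≤x x≤y = ℚ.≤-trans (*-monoˡ-≤ 0≤x (^-mono-≤ n 0≤x x≤y))
  (subst₂ ℚ._≤_ (ℚ.*-comm (y ^ n) x) (ℚ.*-comm (y ^ n) y) (*-monoˡ-≤ (0≤^ n (ℚ.≤-trans 0≤x x≤y)) x≤y))

-- Finite sums and products of reals

Σℝ : ∀ {n} → (Fin n → ℝ) → ℝ
Σℝ = Vector.foldr _+ℝ_ 0ℝ

seq-Σℝ : ∀ {n} (f : Fin n → ℝ) t → seq (Σℝ f) t ≡ sum (λ j → seq (f j) t)
seq-Σℝ {zero}  f t = refl
seq-Σℝ {suc n} f t = cong (seq (f zero) t ℚ.+_) (seq-Σℝ (λ j → f (suc j)) t)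

Σℝ-mono : ∀ {n} (f g : Fin n → ℝ) → (∀ j → f j ⊑ g j) → Σℝ f ⊑ Σℝ g
Σℝ-mono {zero}  f g f≤g = ≤ˢ-refl
Σℝ-mono {suc n} f g f≤g = ≤ˢ-+-mono
  (f≤g zero) (Σℝ-mono (λ j → f (suc j)) (λ j → g (suc j)) (λ j → f≤g (suc j)))

0⊑Σℝ : ∀ {n} (f : Fin n → ℝ) → (∀ j → 0ℝ ⊑ f j) → 0ℝ ⊑ Σℝ f
0⊑Σℝ {zero}  f 0≤f = ≤ˢ-refl
0⊑Σℝ {suc n} f 0≤f = ≤ˢ-trans (≤ˢ-reflexive λ _ → refl)
  (≤ˢ-+-mono (0≤f zero) (0⊑Σℝ (λ j → f (suc j)) (λ j → 0≤f (suc j))))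

term⊑Σℝ : ∀ {n} (f : Fin n → ℝ) → (∀ j → 0ℝ ⊑ f j) → ∀ j → f j ⊑ Σℝ f
term⊑Σℝ f 0≤f zero = ≤ˢ-from (0⊑Σℝ (λ j → f (suc j)) (λ j → 0≤f (suc j)))
  (λ n → sym (ℚ.+-identityʳ _))
term⊑Σℝ f 0≤f (suc j) = ≤ˢ-trans (term⊑Σℝ (λ j → f (suc j)) (λ j → 0≤f (suc j)) j)
  (≤ˢ-from (0≤f zero) (λ n → solve 2 (λ a b → b :+ a := (a :+ b) :+ con 0ℚ) refl (seq (f zero) n) _))
  where open +-*-Solver

module _ {A : Set} where

  ∏ℝ : (A → ℝ) → List A → ℝ
  ∏ℝ f []       = 1ℝ
  ∏ℝ f (e ∷ es) = f e *ℝ ∏ℝ f es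

  ∏ : (A → ℚ) → List A → ℚ
  ∏ f []       = 1ℚ
  ∏ f (e ∷ es) = f e ℚ.* ∏ f es

  -- Real products are formed index by index, so identities between them reduce to identities
  -- between rational products.
  seq-∏ℝ : ∀ f es n → seq (∏ℝ f es) n ≡ ∏ (λ e → seq (f e) n) es
  seq-∏ℝ f []       n = refl
  seq-∏ℝ f (e ∷ es) n = cong (seq (f e) n ℚ.*_) (seq-∏ℝ f es n)

  ∏-++ : ∀ f xs ys → ∏ f (xs ++ ys) ≡ ∏ f xs ℚ.* ∏ f ys
  ∏-++ f []       ys = sym (ℚ.*-identityˡ _)
  ∏-++ f (x ∷ xs) ys = trans (cong (f x ℚ.*_) (∏-++ f xs ys)) (sym (ℚ.*-assoc (f x) _ _))

  ∏-↭ : ∀ f {xs ys} → xs ↭ ys → ∏ f xs ≡ ∏ f ys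
  ∏-↭ f Perm.refl         = refl
  ∏-↭ f (Perm.prep x p)   = cong (f x ℚ.*_) (∏-↭ f p)
  ∏-↭ f (Perm.swap {xs} {ys} x y p) = trans (cong (λ r → f x ℚ.* (f y ℚ.* r)) (∏-↭ f p))
    (solve 3 (λ x y r → x :* (y :* r) := y :* (x :* r)) refl (f x) (f y) (∏ f ys))
    where open +-*-Solver
  ∏-↭ f (Perm.trans p q)  = trans (∏-↭ f p) (∏-↭ f q)

  0⊑∏ℝ : ∀ f es → (∀ e → 0ℝ ⊑ f e) → 0ℝ ⊑ ∏ℝ f es
  0⊑∏ℝ f []       0≤f = fromℚ-mono 0≤1
  0⊑∏ℝ f (e ∷ es) 0≤f = 0⊑* (f e) (∏ℝ f es) (0≤f e) (0⊑∏ℝ f es 0≤f)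

  ∏ℝ-mono : ∀ f g es → (∀ e → 0ℝ ⊑ f e) → (∀ e → 0ℝ ⊑ g e) → (∀ e → e ∈ es → f e ⊑ g e) → ∏ℝ f es ⊑ ∏ℝ g es
  ∏ℝ-mono f g []       0≤f 0≤g f≤g = ≤ˢ-refl
  ∏ℝ-mono f g (e ∷ es) 0≤f 0≤g f≤g = *ℝ-mono (f e) (g e) (∏ℝ f es) (∏ℝ g es) (0≤f e) (0⊑∏ℝ g es 0≤g)
    (f≤g e (here refl)) (∏ℝ-mono f g es 0≤f 0≤g (λ e e∈ → f≤g e (there e∈)))

  ∏ℝ-fromℚ : ∀ q es → seq (∏ℝ (λ e → fromℚ (q e)) es) ≗ seq (fromℚ (∏ q es))
  ∏ℝ-fromℚ q es n = seq-∏ℝ (λ e → fromℚ (q e)) es n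

  ∏-const : ∀ h es → ∏ (λ _ → h) es ≡ h ^ length es
  ∏-const h []       = refl
  ∏-const h (e ∷ es) = cong (h ℚ.*_) (∏-const h es)

  -- Write `F` and `G` for the products of `f` and `g` over `es`. Then `g e * G` is at least
  -- `(f e + h) * G`, hence at least `f e * F + h * G`, and every factor of `G` is at least `h`. The
  -- explicit size of the gap is what contradicts `Indistinct` later.
  ∏ℝ-gap : ∀ f g h e es → (∀ e → 0ℝ ⊑ f e) → (∀ e → 0ℝ ⊑ g e) → 0ℚ ℚ.≤ h →
           (∀ x → x ∈ e ∷ es → f x +ℝ fromℚ h ⊑ g x) →
           ∏ℝ f (e ∷ es) +ℝ fromℚ (h ^ length (e ∷ es)) ⊑ ∏ℝ g (e ∷ es)
  ∏ℝ-gap f g h e es 0≤f 0≤g 0≤h gap = ≤ˢ-trans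
    (≤ˢ-from (≤ˢ-+-mono
                             (*ℝ-monoˡ (f e) F G (0≤f e) (∏ℝ-mono f g es 0≤f 0≤g weak))
                             (*ℝ-monoˡ (fromℚ h) (fromℚ (h ^ length es)) G (fromℚ-mono 0≤h) power))
            (λ n → solve 5 (λ f F h p G → (f :* F :+ h :* p) :+ (f :* G :+ h :* G) := (f :+ h) :* G :+ (f :* F :+ h :* p))
                     refl (seq (f e) n) (seq F n) h (h ^ length es) (seq G n)))
    (*ℝ-monoʳ (f e +ℝ fromℚ h) (g e) G (0⊑∏ℝ g es 0≤g) (gap e (here refl)))
    where
    open +-*-Solver
    F = ∏ℝ f es
    G = ∏ℝ g es
    weak : ∀ x → x ∈ es → f x ⊑ g x
    weak x x∈ = ≤ˢ-trans (≤ˢ-from (fromℚ-mono 0≤h) (λ n → sym (ℚ.+-identityʳ _))) (gap x (there x∈))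
    power : fromℚ (h ^ length es) ⊑ G
    power = ≤ˢ-trans (≤ˢ-reflexive (λ n → sym (trans (∏ℝ-fromℚ (λ _ → h) es n) (∏-const h es))))
      (∏ℝ-mono (λ _ → fromℚ h) g es (λ _ → fromℚ-mono 0≤h) 0≤g (λ x x∈ → ≤ˢ-trans
        (≤ˢ-from (0≤f x) (λ n → solve 2 (λ h f → h :+ f := (f :+ h) :+ con 0ℚ) refl h (seq (f x) n)))
        (gap x (there x∈))))

-- Directions in the space of chains

δ : ∀ {n} → Fin n → Fin n → ℚ
δ i j = if does (i Fin.≟ j) then 1ℚ else 0ℚ

δ-diag : ∀ {n} (i : Fin n) → δ i i ≡ 1ℚ
δ-diag i = cong (if_then 1ℚ else 0ℚ) (dec-true (i Fin.≟ i) refl)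

δ-off : ∀ {n} {i j : Fin n} → i ≢ j → δ i j ≡ 0ℚ
δ-off {i = i} {j} i≢j = cong (if_then 1ℚ else 0ℚ) (dec-false (i Fin.≟ j) i≢j)

sum-0 : ∀ n → sum {n} (λ _ → 0ℚ) ≡ 0ℚ
sum-0 zero    = refl
sum-0 (suc n) = trans (ℚ.+-identityˡ _) (sum-0 n)

sum-δ : ∀ {n} (i : Fin n) → sum (δ i) ≡ 1ℚ
sum-δ {suc n} zero    = cong (1ℚ ℚ.+_) (sum-0 n)
sum-δ {suc n} (suc i) = trans (ℚ.+-identityˡ _) (sum-δ i)

sum-minus : ∀ {n} (f g : Fin n → ℚ) → sum (λ i → f i ℚ.- g i) ≡ sum f ℚ.- sum g
sum-minus {zero}  f g = refl
sum-minus {suc n} f g = trans (cong (f zero ℚ.- g zero ℚ.+_) (sum-minus (f ∘ suc) (g ∘ suc)))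
  (solve 4 (λ a b c d → (a :- b) :+ (c :- d) := (a :+ c) :- (b :+ d)) refl (f zero) (g zero) _ _)
  where open +-*-Solver

sum-const : ∀ n x → sum {n} (λ _ → x) ≡ ν n ℚ.* x
sum-const zero    x = sym (ℚ.*-zeroˡ x)
sum-const (suc n) x = trans (cong (x ℚ.+_) (sum-const n x))
  (solve 2 (λ x n → x :+ n :* x := (con 1ℚ :+ n) :* x) refl x (ν n))
  where open +-*-Solver

-- The possible velocities of a coordinate. As they are integers, lines in the direction run through
-- grid points; as they are at most 1 in absolute value, one step moves no coordinate by more than
-- the mesh.
Trit : ℚ → Set
Trit v = v ≡ 1ℚ ⊎ v ≡ 0ℚ ⊎ v ≡ ℚ.- 1ℚ

Direction : ℕ → Set
Direction k = Fin k → Maybe (Fin k × Fin k)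

-- Transition probabilities move from β to α in every row i with dir i = just (α , β).
velocity : ∀ {k} → Direction k → Fin k → Fin k → ℚ
velocity dir i j = maybe′ (λ (α , β) → δ α j ℚ.- δ β j) 0ℚ (dir i)

velocity-trit : ∀ {k} (dir : Direction k) i j → Trit (velocity dir i j)
velocity-trit dir i j with dir i
... | nothing = inj₂ (inj₁ refl)
... | just (α , β) with does (α Fin.≟ j) | does (β Fin.≟ j)
...   | true  | true  = inj₂ (inj₁ refl)
...   | true  | false = inj₁ refl
...   | false | true  = inj₂ (inj₂ refl)
...   | false | false = inj₂ (inj₁ refl)

-- Mass only moves within a row. Hence the probability of state 0, which is computed as 1 minus the
-- others, also changes at its own velocity.
velocity-sum : ∀ {k} (dir : Direction k) i → sum (velocity dir i) ≡ 0ℚ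
velocity-sum {k} dir i with dir i
... | nothing      = sum-0 k
... | just (α , β) = trans (sum-minus (δ α) (δ β)) (cong₂ ℚ._-_ (sum-δ α) (sum-δ β))

velocity-gain : ∀ {k} (dir : Direction k) {i α β} → dir i ≡ just (α , β) → α ≢ β → velocity dir i α ≡ 1ℚ
velocity-gain dir {i} {α} {β} eq α≢β rewrite eq = cong₂ ℚ._-_ (δ-diag α) (δ-off (α≢β ∘ sym))

velocity-loss : ∀ {k} (dir : Direction k) {i α β} → dir i ≡ just (α , β) → α ≢ β → velocity dir i β ≡ ℚ.- 1ℚ
velocity-loss dir {i} {α} {β} eq α≢β rewrite eq = cong₂ ℚ._-_ (δ-off α≢β) (δ-diag β)

-- One more than the largest s < n at which b fails, and 0 if there is none.
last-failure : (ℕ → Bool) → ℕ → ℕ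
last-failure b zero    = zero
last-failure b (suc n) = if b n then last-failure b n else suc n

last-failure-≤ : ∀ b n {t} → (∀ s → t ℕ.≤ s → b s ≡ true) → last-failure b n ℕ.≤ t
last-failure-≤ b zero    above = ℕ.z≤n
last-failure-≤ b (suc n) {t} above with b n in eq
... | true  = last-failure-≤ b n above
... | false with t ℕ.≤? n
...   | yes t≤n with () ← trans (sym (above n t≤n)) eq
...   | no  t≰n = ℕ.≰⇒> t≰n

-- No monotonicity of `b` is assumed: failures at all places up to `t - c` already push the last one
-- that far. The bound `t ≤ n + c` ensures that the search reaches them.
last-failure-≥ : ∀ b n {t c} → (∀ s → s ℕ.+ c ℕ.≤ t → b s ≡ false) → t ℕ.≤ n ℕ.+ c → t ℕ.≤ last-failure b n ℕ.+ c
last-failure-≥ b zero    below t≤c = t≤c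
last-failure-≥ b (suc n) {t} {c} below t≤n+c with b n in eq
... | false = t≤n+c
... | true with n ℕ.+ c ℕ.≤? t
...   | yes n+c≤t with () ← trans (sym eq) (below n n+c≤t)
...   | no  n+c≰t = last-failure-≥ b n below (ℕ.<⇒≤ (ℕ.≰⇒> n+c≰t))

-- The integer part of a real is not computable. Allowing an error of `2h` instead of `h` makes
-- consecutive intervals overlap, and the overlap is what `cotransitive` needs to choose one.
grid-point : ∀ {h} → 0ℚ ℚ.< h → ∀ N (x : ℝ) → 0ℝ ⊑ x → x ⊑ fromℚ (ν (suc N) ℚ.* h) →
             ∃[ g ] g ℕ.≤ N × fromℚ (ν g ℚ.* h) ⊑ x × x ⊑ fromℚ (ν g ℚ.* h ℚ.+ (h ℚ.+ h))
grid-point {h} 0<h zero x 0≤x x≤h = 0 , ℕ.z≤n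
  , ≤ˢ-trans (fromℚ-mono (ℚ.≤-reflexive (ℚ.*-zeroˡ h))) 0≤x
  , ≤ˢ-trans x≤h (fromℚ-mono (≤-from (ν 1 ℚ.* h) (ν 0 ℚ.* h ℚ.+ (h ℚ.+ h)) (ℚ.<⇒≤ 0<h) (one-step 0ℚ h)))
  where
  open +-*-Solver
  one-step : ∀ n h → (1ℚ ℚ.+ n) ℚ.* h ℚ.+ h ≡ n ℚ.* h ℚ.+ (h ℚ.+ h) ℚ.+ 0ℚ
  one-step = solve 2 (λ n h → (con 1ℚ :+ n) :* h :+ h := n :* h :+ (h :+ h) :+ con 0ℚ) refl
grid-point {h} 0<h (suc N) x 0≤x x≤ = by-cases (cotransitive (step (ν N)) x)
  where
  open +-*-Solver
  one-step : ∀ n h → h ℚ.+ n ℚ.* h ≡ (1ℚ ℚ.+ n) ℚ.* h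
  one-step = solve 2 (λ n h → h :+ n :* h := (con 1ℚ :+ n) :* h) refl
  step : ∀ n → n ℚ.* h ℚ.< (1ℚ ℚ.+ n) ℚ.* h
  step n = subst₂ ℚ._<_ (ℚ.+-identityˡ _) (one-step n h) (ℚ.+-monoˡ-< (n ℚ.* h) 0<h)
  two-steps : ∀ n h → (1ℚ ℚ.+ (1ℚ ℚ.+ n)) ℚ.* h ≡ n ℚ.* h ℚ.+ (h ℚ.+ h)
  two-steps = solve 2 (λ n h → (con 1ℚ :+ (con 1ℚ :+ n)) :* h := n :* h :+ (h :+ h)) refl
  by-cases : x ⊑ fromℚ (ν (suc N) ℚ.* h) ⊎ fromℚ (ν N ℚ.* h) ⊑ x → _
  by-cases (inj₁ x≤′) = let g , g≤N , lo , hi = grid-point 0<h N x 0≤x x≤′ in g , ℕ.m≤n⇒m≤1+n g≤N , lo , hi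
  by-cases (inj₂ ≤x)  = N , ℕ.n≤1+n N , ≤x , ≤ˢ-trans x≤ (fromℚ-mono (ℚ.≤-reflexive (two-steps (ν N) h)))

-- Estimates for sums, products and distributions

product-const : ∀ {n} (f : Fin n → ℚ) x → (∀ i → f i ≡ x) → Vector.foldr ℚ._*_ 1ℚ f ≡ x ^ n
product-const {zero}  f x f≡x = refl
product-const {suc n} f x f≡x = cong₂ ℚ._*_ (f≡x zero) (product-const (f ∘ suc) x (f≡x ∘ suc))

sum-bounded : ∀ (f : ℕ → ℚ) {V} L → 0ℚ ℚ.≤ V → (∀ i → f i ℚ.≤ V) → (∀ i → L ℕ.≤ i → f i ≡ 0ℚ) →
              ∀ n → sum {n} (λ i → f (toℕ i)) ℚ.≤ ν L ℚ.* V
sum-bounded f L       0≤V f≤V f≡0 zero    = 0≤* (0≤ν L) 0≤V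
sum-bounded f {V} zero 0≤V f≤V f≡0 (suc n) = subst (ℚ._≤ 0ℚ ℚ.* V)
  (trans (sym (ℚ.+-identityˡ _)) (cong (ℚ._+ sum (λ i → f (toℕ (suc {n} i)))) (sym (f≡0 0 ℕ.z≤n))))
  (sum-bounded (f ∘ suc) zero 0≤V (f≤V ∘ suc) (λ i _ → f≡0 (suc i) ℕ.z≤n) n)
sum-bounded f {V} (suc L) 0≤V f≤V f≡0 (suc n) = subst (sum (λ i → f (toℕ {suc n} i)) ℚ.≤_)
  (solve 2 (λ V l → V :+ l :* V := (con 1ℚ :+ l) :* V) refl V (ν L))
  (ℚ.+-mono-≤ (f≤V 0) (sum-bounded (f ∘ suc) L 0≤V (f≤V ∘ suc) (λ i L≤i → f≡0 (suc i) (ℕ.s≤s L≤i)) n))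
  where open +-*-Solver

0≤prob : ∀ {k} (d : Distribution k) i → 0ℝ ⊑ prob d i
0≤prob d i = ≤ˢ-intro (Distribution.nonNegative d i)

Σprob≤1 : ∀ {k} (d : Distribution k) → Σℝ (prob d) ⊑ 1ℝ
Σprob≤1 d = ≤ˢ-intro (proj₁ (Distribution.sums-to-1 d))

1≤Σprob : ∀ {k} (d : Distribution k) → 1ℝ ⊑ Σℝ (prob d)
1≤Σprob d = ≤ˢ-intro (proj₂ (Distribution.sums-to-1 d))

prob≤1 : ∀ {k} (d : Distribution k) i → prob d i ⊑ 1ℝ
prob≤1 d i = ≤ˢ-trans (term⊑Σℝ (prob d) (0≤prob d) i) (Σprob≤1 d)

-- The probability of state 0 is 1 minus the sum of the others, so their `k` errors accumulate in
-- its lower bound. Its upper bound has no error because each `q j` bounds from below.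
first-prob-bounds : ∀ {k} (d : Distribution (suc k)) (q : Fin k → ℚ) η →
  (∀ j → fromℚ (q j) ⊑ prob d (suc j) × prob d (suc j) ⊑ fromℚ (q j ℚ.+ η)) →
  fromℚ ((1ℚ ℚ.- sum q) ℚ.- ν k ℚ.* η) ⊑ prob d zero × prob d zero ⊑ fromℚ (1ℚ ℚ.- sum q)
first-prob-bounds {k} d q η bounds =
  ≤ˢ-from (≤ˢ-+-mono (1≤Σprob d) upper)
    (λ n → lo-eq (sum q) (ν k ℚ.* η) (seq (prob d zero) n) (seq (Σℝ y) n)) ,
  ≤ˢ-from (≤ˢ-+-mono (Σprob≤1 d) lower)
    (λ n → hi-eq (sum q) (seq (prob d zero) n) (seq (Σℝ y) n))
  where
  open +-*-Solver
  y : Fin k → ℝ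
  y j = prob d (suc j)
  lower : fromℚ (sum q) ⊑ Σℝ y
  lower = ≤ˢ-trans (≤ˢ-reflexive (λ n → sym (seq-Σℝ (λ j → fromℚ (q j)) n)))
    (Σℝ-mono (λ j → fromℚ (q j)) y (λ j → proj₁ (bounds j)))
  upper : Σℝ y ⊑ fromℚ (sum q ℚ.+ ν k ℚ.* η)
  upper = ≤ˢ-trans (Σℝ-mono y (λ j → fromℚ (q j ℚ.+ η)) (λ j → proj₂ (bounds j)))
    (≤ˢ-reflexive (λ n → trans (seq-Σℝ (λ j → fromℚ (q j ℚ.+ η)) n)
      (trans (∑-distrib-+ q (λ _ → η)) (cong (sum q ℚ.+_) (sum-const k η)))))
  lo-eq : ∀ s e y0 y → ((1ℚ ℚ.- s) ℚ.- e) ℚ.+ ((y0 ℚ.+ y) ℚ.+ (s ℚ.+ e)) ≡ y0 ℚ.+ (1ℚ ℚ.+ y)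
  lo-eq = solve 4 (λ s e y0 y → ((con 1ℚ :- s) :- e) :+ ((y0 :+ y) :+ (s :+ e)) := y0 :+ (con 1ℚ :+ y)) refl
  hi-eq : ∀ s y0 y → y0 ℚ.+ (1ℚ ℚ.+ y) ≡ (1ℚ ℚ.- s) ℚ.+ ((y0 ℚ.+ y) ℚ.+ s)
  hi-eq = solve 3 (λ s y0 y → y0 :+ (con 1ℚ :+ y) := (con 1ℚ :- s) :+ ((y0 :+ y) :+ s)) refl

-- Transfers a comparison from the rational values `Q` to the real values `f`. Passing from `f` to
-- `Q` raises every factor of the first product by at least `h` and raises none of the second; so if
-- the first is not the larger one at `Q`, it is smaller by a definite amount at `f`.
∏-separated : ∀ {A : Set} (f : A → ℝ) (Q : A → ℚ) {h} x xs ys → 0ℚ ℚ.≤ h → (∀ e → 0ℝ ⊑ f e) →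
  (∀ e → e ∈ x ∷ xs → f e +ℝ fromℚ h ⊑ fromℚ (Q e)) → (∀ e → e ∈ ys → fromℚ (Q e) ⊑ f e) →
  ∏ (λ e → 0ℚ ℚ.⊔ Q e) (x ∷ xs) ℚ.≤ ∏ (λ e → 0ℚ ℚ.⊔ Q e) ys →
  ∏ℝ f (x ∷ xs) +ℝ fromℚ (h ^ length (x ∷ xs)) ⊑ ∏ℝ f ys
∏-separated f Q {h} x xs ys 0≤h 0≤f below above le = ≤ˢ-trans
  (∏ℝ-gap f (λ e → fromℚ (0ℚ ℚ.⊔ Q e)) h x xs 0≤f 0≤Q⁺ 0≤h (λ e e∈ → ≤ˢ-trans (below e e∈) (fromℚ-mono (ℚ.p≤q⊔p 0ℚ (Q e)))))
  (≤ˢ-trans (≤ˢ-reflexive (∏ℝ-fromℚ (λ e → 0ℚ ℚ.⊔ Q e) (x ∷ xs)))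
  (≤ˢ-trans (fromℚ-mono le)
  (≤ˢ-trans (≤ˢ-reflexive (λ n → sym (∏ℝ-fromℚ (λ e → 0ℚ ℚ.⊔ Q e) ys n)))
            (∏ℝ-mono (λ e → fromℚ (0ℚ ℚ.⊔ Q e)) f ys 0≤Q⁺ 0≤f (λ e e∈ → ⊔-lub (Q e) (f e) (above e e∈) (0≤f e))))))
  where
  0≤Q⁺ : ∀ e → 0ℝ ⊑ fromℚ (0ℚ ℚ.⊔ Q e)
  0≤Q⁺ e = fromℚ-mono (ℚ.p≤p⊔q 0ℚ (Q e))
  ⊔-lub : ∀ q x → fromℚ q ⊑ x → 0ℝ ⊑ x → fromℚ (0ℚ ℚ.⊔ q) ⊑ x
  ⊔-lub q x q≤x 0≤x = by-cases (ℚ.≤-total 0ℚ q)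
    where
    by-cases : 0ℚ ℚ.≤ q ⊎ q ℚ.≤ 0ℚ → fromℚ (0ℚ ℚ.⊔ q) ⊑ x
    by-cases (inj₁ 0≤q) = ≤ˢ-trans (fromℚ-mono (ℚ.≤-reflexive (ℚ.p≤q⇒p⊔q≡q 0≤q))) q≤x
    by-cases (inj₂ q≤0) = ≤ˢ-trans (fromℚ-mono (ℚ.≤-reflexive (ℚ.p≥q⇒p⊔q≡p q≤0))) 0≤x

-- Lines of grid points

trit-bound : ∀ {v X Z} → Trit v → 0ℚ ℚ.≤ Z → ℚ.- Z ℚ.≤ X → X ℚ.≤ Z → ℚ.- Z ℚ.≤ v ℚ.* X × v ℚ.* X ℚ.≤ Z
trit-bound {X = X} (inj₁ refl) 0≤Z -Z≤X X≤Z =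
  subst (_ ℚ.≤_) (sym (ℚ.*-identityˡ X)) -Z≤X , subst (ℚ._≤ _) (sym (ℚ.*-identityˡ X)) X≤Z
trit-bound {X = X} (inj₂ (inj₁ refl)) 0≤Z -Z≤X X≤Z =
  subst (_ ℚ.≤_) (sym (ℚ.*-zeroˡ X)) (ℚ.neg-antimono-≤ 0≤Z) , subst (ℚ._≤ _) (sym (ℚ.*-zeroˡ X)) 0≤Z
trit-bound {X = X} {Z} (inj₂ (inj₂ refl)) 0≤Z -Z≤X X≤Z =
  ≤-from _ _ X≤Z (solve 2 (λ X Z → :- Z :+ Z := con (ℚ.- 1ℚ) :* X :+ X) refl X Z) ,
  ≤-from _ _ -Z≤X (solve 2 (λ X Z → con (ℚ.- 1ℚ) :* X :+ X := Z :+ :- Z) refl X Z)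
  where open +-*-Solver

ν-∸ : ∀ {m n} → m ℕ.≤ n → ν (n ℕ.∸ m) ≡ ν n ℚ.- ν m
ν-∸ {m} {n} m≤n = begin
  ν (n ℕ.∸ m)                        ≡⟨ solve 2 (λ a b → a := (a :+ b) :- b) refl (ν (n ℕ.∸ m)) (ν m) ⟩
  (ν (n ℕ.∸ m) ℚ.+ ν m) ℚ.- ν m      ≡⟨ cong (ℚ._- ν m) (ν-+ (n ℕ.∸ m) m) ⟨
  ν (n ℕ.∸ m ℕ.+ m) ℚ.- ν m          ≡⟨ cong (λ x → ν x ℚ.- ν m) (ℕ.m∸n+n≡m m≤n) ⟩
  ν n ℚ.- ν m                        ∎
  where open ≡-Reasoning ; open +-*-Solver

-- The solution is `w = N + g - v (s - N)`. It lies between 0 and `3N` because `g` and the distance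
-- from `s` to `N` are at most `N`; the shift by `N` avoids negative numbers.
line-offset : ∀ {v N g s} → Trit v → g ℕ.≤ N → s ℕ.≤ N ℕ.+ N →
              ∃[ w ] w ℕ.≤ N ℕ.+ N ℕ.+ N × ν w ℚ.- ν N ℚ.+ v ℚ.* (ν s ℚ.- ν N) ≡ ν g
line-offset {v} {N} {g} {s} (inj₁ refl) g≤N s≤2N = N ℕ.+ N ℕ.∸ s ℕ.+ g , ℕ.+-mono-≤ (ℕ.m∸n≤m (N ℕ.+ N) s) g≤N , (begin
  ν (N ℕ.+ N ℕ.∸ s ℕ.+ g) ℚ.- ν N ℚ.+ 1ℚ ℚ.* (ν s ℚ.- ν N)
    ≡⟨ cong (λ x → x ℚ.- ν N ℚ.+ 1ℚ ℚ.* (ν s ℚ.- ν N))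
         (trans (ν-+ (N ℕ.+ N ℕ.∸ s) g) (cong (ℚ._+ ν g) (trans (ν-∸ s≤2N) (cong (ℚ._- ν s) (ν-+ N N))))) ⟩
  (ν N ℚ.+ ν N ℚ.- ν s ℚ.+ ν g) ℚ.- ν N ℚ.+ 1ℚ ℚ.* (ν s ℚ.- ν N)
    ≡⟨ solve 3 (λ n s g → (n :+ n :- s :+ g) :- n :+ con 1ℚ :* (s :- n) := g) refl (ν N) (ν s) (ν g) ⟩
  ν g ∎)
  where open ≡-Reasoning ; open +-*-Solver
line-offset {v} {N} {g} {s} (inj₂ (inj₁ refl)) g≤N s≤2N = N ℕ.+ g , ℕ.+-mono-≤ (ℕ.m≤m+n N N) g≤N , (begin
  ν (N ℕ.+ g) ℚ.- ν N ℚ.+ 0ℚ ℚ.* (ν s ℚ.- ν N)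
    ≡⟨ cong (λ x → x ℚ.- ν N ℚ.+ 0ℚ ℚ.* (ν s ℚ.- ν N)) (ν-+ N g) ⟩
  (ν N ℚ.+ ν g) ℚ.- ν N ℚ.+ 0ℚ ℚ.* (ν s ℚ.- ν N)
    ≡⟨ solve 3 (λ n s g → (n :+ g) :- n :+ con 0ℚ :* (s :- n) := g) refl (ν N) (ν s) (ν g) ⟩
  ν g ∎)
  where open ≡-Reasoning ; open +-*-Solver
line-offset {v} {N} {g} {s} (inj₂ (inj₂ refl)) g≤N s≤2N = s ℕ.+ g , ℕ.+-mono-≤ s≤2N g≤N , (begin
  ν (s ℕ.+ g) ℚ.- ν N ℚ.+ ℚ.- 1ℚ ℚ.* (ν s ℚ.- ν N)
    ≡⟨ cong (λ x → x ℚ.- ν N ℚ.+ ℚ.- 1ℚ ℚ.* (ν s ℚ.- ν N)) (ν-+ s g) ⟩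
  (ν s ℚ.+ ν g) ℚ.- ν N ℚ.+ ℚ.- 1ℚ ℚ.* (ν s ℚ.- ν N)
    ≡⟨ solve 3 (λ n s g → (s :+ g) :- n :+ con (ℚ.- 1ℚ) :* (s :- n) := g) refl (ν N) (ν s) (ν g) ⟩
  ν g ∎)
  where open ≡-Reasoning ; open +-*-Solver

-- Solving for the parameter instead of the offset at one moving coordinate lets that coordinate
-- start at 0 on every line. This removes one dimension from the family of lines.
pivot-parameter : ∀ {v N g} → v ≡ 1ℚ ⊎ v ≡ ℚ.- 1ℚ → g ℕ.≤ N →
                  ∃[ s ] s ℕ.≤ N ℕ.+ N × v ℚ.* (ν s ℚ.- ν N) ≡ ν g
pivot-parameter {v} {N} {g} (inj₁ refl) g≤N = N ℕ.+ g , ℕ.+-monoʳ-≤ N g≤N ,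
  trans (cong (λ x → 1ℚ ℚ.* (x ℚ.- ν N)) (ν-+ N g))
    (solve 2 (λ n g → con 1ℚ :* ((n :+ g) :- n) := g) refl (ν N) (ν g))
  where open +-*-Solver
pivot-parameter {v} {N} {g} (inj₂ refl) g≤N = N ℕ.∸ g , ℕ.≤-trans (ℕ.m∸n≤m N g) (ℕ.m≤m+n N N) ,
  trans (cong (λ x → ℚ.- 1ℚ ℚ.* (x ℚ.- ν N)) (ν-∸ g≤N))
    (solve 2 (λ n g → con (ℚ.- 1ℚ) :* ((n :- g) :- n) := g) refl (ν N) (ν g))
  where open +-*-Solver

insertAt-cong : ∀ {A : Set} {n} {xs ys : Fin n → A} → xs ≗ ys → ∀ i v → insertAt xs i v ≗ insertAt ys i v
insertAt-cong eq zero    v zero    = refl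
insertAt-cong eq zero    v (suc j) = eq j
insertAt-cong {n = suc n} eq (suc i) v zero    = eq zero
insertAt-cong {n = suc n} eq (suc i) v (suc j) = insertAt-cong (eq ∘ suc) i v j

module Lines {κ : ℕ} (dir : Direction (suc (suc κ))) (h : ℚ) (0<h : 0ℚ ℚ.< h) (N : ℕ) where

  k : ℕ
  k = suc (suc κ)

  Index : Set
  Index = Fin (suc k) → Fin (suc κ) → ℕ

  -- Row 0 is the initial distribution. It does not move, as the products to be compared contain
  -- transition probabilities only.
  V : Fin (suc k) → Fin (suc κ) → ℚ
  V zero    j = 0ℚ
  V (suc i) j = velocity dir i (suc j)

  V-trit : ∀ r j → Trit (V r j)
  V-trit zero    j = inj₂ (inj₁ refl)
  V-trit (suc i) j = velocity-trit dir i (suc j)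

  -- The grid coordinates w - N + V (s - N) are integers; w and s are shifted by N to be natural.
  point : Index → ℕ → Fin (suc k) → Fin (suc κ) → ℚ
  point w s r j = (ν (w r j) ℚ.- ν N ℚ.+ V r j ℚ.* (ν s ℚ.- ν N)) ℚ.* h

  point-prob : Index → ℕ → Fin k × Fin k → ℚ
  point-prob w s (i , zero)  = 1ℚ ℚ.- sum (point w s (suc i))
  point-prob w s (i , suc j) = point w s (suc i) j

  point-shift : ∀ w s s′ r j → point w s′ r j ≡ point w s r j ℚ.+ V r j ℚ.* ((ν s′ ℚ.- ν s) ℚ.* h)
  point-shift w s s′ r j = solve 6 (λ w n v s s′ h →
    (w :- n :+ v :* (s′ :- n)) :* h := (w :- n :+ v :* (s :- n)) :* h :+ v :* ((s′ :- s) :* h))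
    refl (ν (w r j)) (ν N) (V r j) (ν s) (ν s′) h
    where open +-*-Solver

  prob-shift : ∀ w s s′ i j →
    point-prob w s′ (i , j) ≡ point-prob w s (i , j) ℚ.+ velocity dir i j ℚ.* ((ν s′ ℚ.- ν s) ℚ.* h)
  prob-shift w s s′ i (suc j) = point-shift w s s′ (suc i) j
  prob-shift w s s′ i zero = begin
    1ℚ ℚ.- sum (point w s′ (suc i))
      ≡⟨ cong (λ x → 1ℚ ℚ.- x) (sum-cong-≗ (point-shift w s s′ (suc i))) ⟩
    1ℚ ℚ.- sum (λ j → point w s (suc i) j ℚ.+ V (suc i) j ℚ.* X)
      ≡⟨ cong (λ x → 1ℚ ℚ.- x) (∑-distrib-+ (point w s (suc i)) (λ j → V (suc i) j ℚ.* X)) ⟩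
    1ℚ ℚ.- (Σp ℚ.+ sum (λ j → V (suc i) j ℚ.* X))
      ≡⟨ cong (λ x → 1ℚ ℚ.- (Σp ℚ.+ x)) (*-distribʳ-sum X (V (suc i))) ⟨
    -- `ΣV` omits state 0; adding and subtracting that velocity completes the row, whose sum is 0.
    1ℚ ℚ.- (Σp ℚ.+ ΣV ℚ.* X)
      ≡⟨ solve 4 (λ p V X v → con 1ℚ :- (p :+ V :* X) := con 1ℚ :- p :+ (v :* X :- (v :+ V) :* X)) refl Σp ΣV X (velocity dir i zero) ⟩
    1ℚ ℚ.- Σp ℚ.+ (velocity dir i zero ℚ.* X ℚ.- sum (velocity dir i) ℚ.* X)
      ≡⟨ cong (λ z → 1ℚ ℚ.- Σp ℚ.+ (velocity dir i zero ℚ.* X ℚ.- z ℚ.* X)) (velocity-sum dir i) ⟩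
    1ℚ ℚ.- Σp ℚ.+ (velocity dir i zero ℚ.* X ℚ.- 0ℚ ℚ.* X)
      ≡⟨ cong (1ℚ ℚ.- Σp ℚ.+_) (solve 2 (λ v X → v :* X :- con 0ℚ :* X := v :* X) refl (velocity dir i zero) X) ⟩
    1ℚ ℚ.- Σp ℚ.+ velocity dir i zero ℚ.* X ∎
    where
    open ≡-Reasoning ; open +-*-Solver
    X = (ν s′ ℚ.- ν s) ℚ.* h
    Σp = sum (point w s (suc i))
    ΣV = sum (V (suc i))

-- The sign change on a line

weight : ∀ {k} → Chain k → Fin k × Fin k → ℝ
weight M e = prob (transition M (proj₁ e)) (proj₂ e)

0≤weight : ∀ {k} (M : Chain k) e → 0ℝ ⊑ weight M e
0≤weight M e = 0≤prob (transition M (proj₁ e)) (proj₂ e)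

-- Equality of the two products in negative form: neither exceeds the other by a positive rational.
-- This is all that the Viterbi inequalities yield constructively, and it suffices to refute a wrong
-- outcome of a rational comparison.
Indistinct : ∀ {k} → List (Fin k × Fin k) → List (Fin k × Fin k) → Chain k → Set
Indistinct E F M = (∀ η → 0ℚ ℚ.< η → ¬ (∏ℝ (weight M) E +ℝ fromℚ η ⊑ ∏ℝ (weight M) F))
                 × (∀ η → 0ℚ ℚ.< η → ¬ (∏ℝ (weight M) F +ℝ fromℚ η ⊑ ∏ℝ (weight M) E))

module SignChange {κ : ℕ} (dir : Direction (suc (suc κ))) (h : ℚ) (0<h : 0ℚ ℚ.< h) (N : ℕ)
  (x₁ : Fin (suc (suc κ)) × Fin (suc (suc κ))) (X₁ : List (Fin (suc (suc κ)) × Fin (suc (suc κ))))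
  (x₂ : Fin (suc (suc κ)) × Fin (suc (suc κ))) (X₂ : List (Fin (suc (suc κ)) × Fin (suc (suc κ))))
  (up   : ∀ e → e ∈ x₁ ∷ X₁ → velocity dir (proj₁ e) (proj₂ e) ≡ 1ℚ)
  (down : ∀ e → e ∈ x₂ ∷ X₂ → velocity dir (proj₁ e) (proj₂ e) ≡ ℚ.- 1ℚ) where

  open Lines dir h 0<h N

  -- For a chain within `2h` of a grid point, each of the `suc κ` free coordinates errs by at most
  -- `2h`, and the probability of state 0 collects all these errors; so every transition probability
  -- errs by at most `c * h`. A move of `K = c + 1` steps outweighs this with `h` to spare.
  c K : ℕ
  c = suc κ ℕ.+ suc κ
  K = suc c

  Near : Index → ℕ → Chain k → Set
  Near w s M = ∀ r j → fromℚ (point w s r j) ⊑ coordinate M r j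
                     × coordinate M r j ⊑ fromℚ (point w s r j ℚ.+ (h ℚ.+ h))

  0≤h : 0ℚ ℚ.≤ h
  0≤h = ℚ.<⇒≤ 0<h

  0≤ch : 0ℚ ℚ.≤ ν c ℚ.* h
  0≤ch = 0≤* (0≤ν c) 0≤h

  2h≤ch : h ℚ.+ h ℚ.≤ ν c ℚ.* h
  2h≤ch = subst₂ ℚ._≤_ (double h) (ℚ.*-comm h (ν c))
    (*-monoˡ-≤ 0≤h (ν-mono {2} {c} (ℕ.s≤s (subst (1 ℕ.≤_) (sym (ℕ.+-suc κ κ)) (ℕ.s≤s ℕ.z≤n)))))
    where
    open +-*-Solver
    double : ∀ h → h ℚ.* (1ℚ ℚ.+ (1ℚ ℚ.+ 0ℚ)) ≡ h ℚ.+ h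
    double = solve 1 (λ h → h :* (con 1ℚ :+ (con 1ℚ :+ con 0ℚ)) := h :+ h) refl

  p≤p+q : ∀ {p q} → 0ℚ ℚ.≤ q → p ℚ.≤ p ℚ.+ q
  p≤p+q {p} {q} 0≤q = subst (ℚ._≤ p ℚ.+ q) (ℚ.+-identityʳ p) (ℚ.+-monoʳ-≤ p 0≤q)

  p-q≤p : ∀ {p q} → 0ℚ ℚ.≤ q → p ℚ.- q ℚ.≤ p
  p-q≤p {p} {q} 0≤q = subst (p ℚ.- q ℚ.≤_) (ℚ.+-identityʳ p) (ℚ.+-monoʳ-≤ p (ℚ.neg-antimono-≤ 0≤q))

  near-prob : ∀ {w s M} → Near w s M → ∀ i j →
    fromℚ (point-prob w s (i , j) ℚ.- ν c ℚ.* h) ⊑ weight M (i , j) ×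
    weight M (i , j) ⊑ fromℚ (point-prob w s (i , j) ℚ.+ ν c ℚ.* h)
  near-prob {w} {s} near i (suc j) =
    ≤ˢ-trans (fromℚ-mono (p-q≤p 0≤ch)) (proj₁ (near (suc i) j)) ,
    ≤ˢ-trans (proj₂ (near (suc i) j)) (fromℚ-mono (ℚ.+-monoʳ-≤ (point w s (suc i) j) 2h≤ch))
  near-prob {w} {s} {M} near i zero =
    ≤ˢ-trans (fromℚ-mono (ℚ.≤-reflexive (cong (λ z → (1ℚ ℚ.- sum (point w s (suc i))) ℚ.- z) ch-eq))) (proj₁ bounds) ,
    ≤ˢ-trans (proj₂ bounds) (fromℚ-mono (p≤p+q 0≤ch))
    where
    open +-*-Solver
    bounds : fromℚ ((1ℚ ℚ.- sum (point w s (suc i))) ℚ.- ν (suc κ) ℚ.* (h ℚ.+ h)) ⊑ prob (transition M i) zero ×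
             prob (transition M i) zero ⊑ fromℚ (1ℚ ℚ.- sum (point w s (suc i)))
    bounds = first-prob-bounds (transition M i) (point w s (suc i)) (h ℚ.+ h) (near (suc i))
    ch-eq : ν c ℚ.* h ≡ ν (suc κ) ℚ.* (h ℚ.+ h)
    ch-eq = trans (cong (ℚ._* h) (ν-+ (suc κ) (suc κ)))
      (regroup (ν (suc κ)) h)
      where
      regroup : ∀ a h → (a ℚ.+ a) ℚ.* h ≡ a ℚ.* (h ℚ.+ h)
      regroup = solve 2 (λ a h → (a :+ a) :* h := a :* (h :+ h)) refl

  shift-eq : ∀ w s s′ i j → point-prob w s′ (i , j) ≡ point-prob w s (i , j) ℚ.+ h ℚ.* (velocity dir i j ℚ.* (ν s′ ℚ.- ν s))
  shift-eq w s s′ i j = trans (prob-shift w s s′ i j) (cong (point-prob w s (i , j) ℚ.+_)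
    (regroup (velocity dir i j) (ν s′ ℚ.- ν s) h))
    where
    open +-*-Solver
    regroup : ∀ v x h → v ℚ.* (x ℚ.* h) ≡ h ℚ.* (v ℚ.* x)
    regroup = solve 3 (λ v x h → v :* (x :* h) := h :* (v :* x)) refl

  point-above : ∀ {w s s′ M} → Near w s M → ∀ i j → ν K ℚ.≤ velocity dir i j ℚ.* (ν s′ ℚ.- ν s) →
                weight M (i , j) +ℝ fromℚ h ⊑ fromℚ (point-prob w s′ (i , j))
  point-above {w} {s} {s′} {M} near i j K≤ = ≤ˢ-trans
    (≤ˢ-+-mono (proj₂ (near-prob {w} {s} {M} near i j)) (≤ˢ-refl {seq (fromℚ h)}))
    (fromℚ-mono (subst (_ ℚ.≤_) (sym (shift-eq w s s′ i j))
      (≤-from _ _ (*-monoˡ-≤ 0≤h K≤) (regroup (point-prob w s (i , j)) (ν c) h (velocity dir i j ℚ.* (ν s′ ℚ.- ν s))))))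
    where
    open +-*-Solver
    regroup : ∀ p c h T → p ℚ.+ c ℚ.* h ℚ.+ h ℚ.+ h ℚ.* T ≡ p ℚ.+ h ℚ.* T ℚ.+ h ℚ.* (1ℚ ℚ.+ c)
    regroup = solve 4 (λ p c h T → p :+ c :* h :+ h :+ h :* T := p :+ h :* T :+ h :* (con 1ℚ :+ c)) refl

  point-below : ∀ {w s s′ M} → Near w s M → ∀ i j → velocity dir i j ℚ.* (ν s′ ℚ.- ν s) ℚ.≤ ℚ.- ν K →
                fromℚ (point-prob w s′ (i , j)) ⊑ weight M (i , j)
  point-below {w} {s} {s′} {M} near i j ≤-K = ≤ˢ-trans
    (fromℚ-mono (subst (ℚ._≤ _) (sym (shift-eq w s s′ i j))
      (≤-from _ _ (ℚ.+-mono-≤ (*-monoˡ-≤ 0≤h ≤-K) 0≤h)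
        (regroup (point-prob w s (i , j)) (ν c) h (velocity dir i j ℚ.* (ν s′ ℚ.- ν s))))))
    (proj₁ (near-prob {w} {s} {M} near i j))
    where
    open +-*-Solver
    regroup : ∀ p c h T → p ℚ.+ h ℚ.* T ℚ.+ (h ℚ.* (ℚ.- (1ℚ ℚ.+ c)) ℚ.+ h) ≡ p ℚ.- c ℚ.* h ℚ.+ (h ℚ.* T ℚ.+ 0ℚ)
    regroup = solve 4 (λ p c h T → p :+ h :* T :+ (h :* (:- (con 1ℚ :+ c)) :+ h) := p :- c :* h :+ (h :* T :+ con 0ℚ)) refl

  advance : ∀ {s s′} → s ℕ.+ K ℕ.≤ s′ → ν K ℚ.≤ ν s′ ℚ.- ν s
  advance {s} {s′} le = ≤-from _ _ (ν-mono le) 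
    (trans (regroup (ν K) (ν s) (ν s′)) (cong (ν s′ ℚ.- ν s ℚ.+_) (sym (ν-+ s K))))
    where
    open +-*-Solver
    regroup : ∀ K s s′ → K ℚ.+ s′ ≡ s′ ℚ.- s ℚ.+ (s ℚ.+ K)
    regroup = solve 3 (λ K s s′ → K :+ s′ := s′ :- s :+ (s :+ K)) refl

  -- Truncation at 0 keeps the products monotone at grid points outside the simplex.
  Q⁺ : Index → ℕ → Fin k × Fin k → ℚ
  Q⁺ w s e = 0ℚ ℚ.⊔ point-prob w s e

  -- The comparison takes place at rational points, where it is decidable.
  positive? : Index → ℕ → Bool
  positive? w s = does (∏ (Q⁺ w s) (x₂ ∷ X₂) ℚ.<? ∏ (Q⁺ w s) (x₁ ∷ X₁))

  crossing : Index → ℕ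
  crossing w = last-failure (positive? w) (N ℕ.+ N)

  -- At `K` or more steps beyond `s`, the increasing factors exceed those of `M` by at least `h` and
  -- the decreasing ones are not above those of `M`. A failing test there would separate the two
  -- products at `M`, contrary to `Indistinct`. Before `s` the roles are exchanged.
  crossing-near : ∀ {w s M} → s ℕ.≤ N ℕ.+ N → Near w s M → Indistinct (x₁ ∷ X₁) (x₂ ∷ X₂) M →
                  crossing w ℕ.≤ s ℕ.+ K × s ℕ.≤ crossing w ℕ.+ K
  crossing-near {w} {s} {M} s≤2N near (¬12 , ¬21) =
    last-failure-≤ (positive? w) (N ℕ.+ N) {s ℕ.+ K} after ,
    last-failure-≥ (positive? w) (N ℕ.+ N) {s} {K} before (ℕ.≤-trans s≤2N (ℕ.m≤m+n _ K))
    where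
    1* : ∀ {v x} → v ≡ 1ℚ → v ℚ.* x ≡ x
    1* {x = x} refl = ℚ.*-identityˡ x
    -1* : ∀ {v x} → v ≡ ℚ.- 1ℚ → v ℚ.* x ≡ ℚ.- x
    -1* {x = x} refl = trans (sym (ℚ.neg-distribˡ-* 1ℚ x)) (cong ℚ.-_ (ℚ.*-identityˡ x))
    swap- : ∀ x y → ℚ.- (x ℚ.- y) ≡ y ℚ.- x
    swap- = solve 2 (λ x y → :- (x :- y) := y :- x) refl
      where open +-*-Solver
    after : ∀ s′ → s ℕ.+ K ℕ.≤ s′ → positive? w s′ ≡ true
    after s′ le = dec-true (_ ℚ.<? _) (ℚ.≰⇒> λ ≤′ → ¬12 _ (0<^ (length (x₁ ∷ X₁)) 0<h)
      (∏-separated (weight M) (point-prob w s′) x₁ X₁ (x₂ ∷ X₂) 0≤h (0≤weight M)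
        (λ e e∈ → point-above {w} {s} {s′} {M} near (proj₁ e) (proj₂ e)
           (subst (ν K ℚ.≤_) (sym (1* (up e e∈))) (advance le)))
        (λ e e∈ → point-below {w} {s} {s′} {M} near (proj₁ e) (proj₂ e)
           (subst (ℚ._≤ ℚ.- ν K) (sym (-1* (down e e∈))) (ℚ.neg-antimono-≤ (advance le))))
        ≤′))
    before : ∀ s′ → s′ ℕ.+ K ℕ.≤ s → positive? w s′ ≡ false
    before s′ le = dec-false (_ ℚ.<? _) (λ lt → ¬21 _ (0<^ (length (x₂ ∷ X₂)) 0<h)
      (∏-separated (weight M) (point-prob w s′) x₂ X₂ (x₁ ∷ X₁) 0≤h (0≤weight M)
        (λ e e∈ → point-above {w} {s} {s′} {M} near (proj₁ e) (proj₂ e)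
           (subst (ν K ℚ.≤_) (sym (trans (-1* (down e e∈)) (swap- (ν s′) (ν s)))) (advance le)))
        (λ e e∈ → point-below {w} {s} {s′} {M} near (proj₁ e) (proj₂ e)
           (subst (ℚ._≤ ℚ.- ν K) (trans (swap- (ν s) (ν s′)) (sym (1* (up e e∈)))) (ℚ.neg-antimono-≤ (advance le))))
        (ℚ.<⇒≤ lt)))

-- A cover with one box for each line

module LineCover {κ : ℕ} (dir : Direction (suc (suc κ))) (h : ℚ) (0<h : 0ℚ ℚ.< h) (N : ℕ) (Nh≡1 : ν N ℚ.* h ≡ 1ℚ)
  (x₁ : Fin (suc (suc κ)) × Fin (suc (suc κ))) (X₁ : List (Fin (suc (suc κ)) × Fin (suc (suc κ))))
  (x₂ : Fin (suc (suc κ)) × Fin (suc (suc κ))) (X₂ : List (Fin (suc (suc κ)) × Fin (suc (suc κ))))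
  (up   : ∀ e → e ∈ x₁ ∷ X₁ → velocity dir (proj₁ e) (proj₂ e) ≡ 1ℚ)
  (down : ∀ e → e ∈ x₂ ∷ X₂ → velocity dir (proj₁ e) (proj₂ e) ≡ ℚ.- 1ℚ)
  (i₀ : Fin (suc (suc κ))) (j₀ : Fin (suc κ))
  (pivot : velocity dir i₀ (suc j₀) ≡ 1ℚ ⊎ velocity dir i₀ (suc j₀) ≡ ℚ.- 1ℚ) where

  open Lines dir h 0<h N
  open SignChange dir h 0<h N x₁ X₁ x₂ X₂ up down

  -- The crossing is at most `K` steps away from the parameter of the chain, which accounts for
  -- `K * h` in each coordinate; the rounding of the chain accounts for `2h`.
  radius : ℚ
  radius = (ν K ℚ.* h) ℚ.+ (h ℚ.+ h)

  0≤Kh : 0ℚ ℚ.≤ ν K ℚ.* h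
  0≤Kh = 0≤* (0≤ν K) 0≤h

  0≤radius : 0ℚ ℚ.≤ radius
  0≤radius = ℚ.+-mono-≤ 0≤Kh (ℚ.+-mono-≤ 0≤h 0≤h)

  box : Index → Box k
  box w r j .lo = point w (crossing w) r j ℚ.- radius
  box w r j .hi = point w (crossing w) r j ℚ.+ radius
  box w r j .lo≤hi = let p = point w (crossing w) r j in ℚ.≤-trans (p-q≤p {p} 0≤radius) (p≤p+q {p} 0≤radius)

  width-box : ∀ w r j → width (box w r j) ≡ radius ℚ.+ radius
  width-box w r j = solve 2 (λ p d → (p :+ d) :- (p :- d) := d :+ d) refl (point w (crossing w) r j) radius
    where open +-*-Solver

  volume-box : ∀ w → volume (box w) ≡ (radius ℚ.+ radius) ^ (suc κ ℕ.* suc k)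
  volume-box w = trans
    (product-const (λ r → Vector.foldr ℚ._*_ 1ℚ (λ j → width (box w r j))) ((radius ℚ.+ radius) ^ suc κ)
       (λ r → product-const (λ j → width (box w r j)) (radius ℚ.+ radius) (width-box w r)))
    (^-assocʳ (radius ℚ.+ radius) (suc κ) (suc k))

  ∈box : ∀ {w s M} → s ℕ.≤ N ℕ.+ N → Near w s M → Indistinct (x₁ ∷ X₁) (x₂ ∷ X₂) M → M ∈Box box w
  ∈box {w} {s} {M} s≤2N near ind r j =
    ≤ˢ-elim (≤ˢ-trans (fromℚ-mono lower) (proj₁ (near r j))) ,
    ≤ˢ-elim (≤ˢ-trans (proj₂ (near r j)) (fromℚ-mono upper))
    where
    open +-*-Solver
    t = crossing w
    close : t ℕ.≤ s ℕ.+ K × s ℕ.≤ t ℕ.+ K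
    close = crossing-near {w} {s} {M} s≤2N near ind
    X = (ν t ℚ.- ν s) ℚ.* h
    ν≤ : ∀ {a b} → a ℕ.≤ b ℕ.+ K → ν a ℚ.≤ ν b ℚ.+ ν K
    ν≤ {a} {b} le = subst (ν a ℚ.≤_) (ν-+ b K) (ν-mono le)
    below : ∀ s t K h → ℚ.- (K ℚ.* h) ℚ.+ h ℚ.* (t ℚ.+ K) ≡ (t ℚ.- s) ℚ.* h ℚ.+ h ℚ.* s
    below = solve 4 (λ s t K h → :- (K :* h) :+ h :* (t :+ K) := (t :- s) :* h :+ h :* s) refl
    above : ∀ s t K h → (t ℚ.- s) ℚ.* h ℚ.+ h ℚ.* (s ℚ.+ K) ≡ K ℚ.* h ℚ.+ h ℚ.* t
    above = solve 4 (λ s t K h → (t :- s) :* h :+ h :* (s :+ K) := K :* h :+ h :* t) refl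
    bounds : ℚ.- (ν K ℚ.* h) ℚ.≤ V r j ℚ.* X × V r j ℚ.* X ℚ.≤ ν K ℚ.* h
    bounds = trit-bound (V-trit r j) 0≤Kh
      (≤-from _ _ (*-monoˡ-≤ 0≤h (ν≤ {s} {t} (proj₂ close))) (below (ν s) (ν t) (ν K) h))
      (≤-from _ _ (*-monoˡ-≤ 0≤h (ν≤ {t} {s} (proj₁ close))) (above (ν s) (ν t) (ν K) h))
    lower-eq : ∀ p Y Z H → (p ℚ.+ Y) ℚ.- (Z ℚ.+ H) ℚ.+ (Z ℚ.+ H) ≡ p ℚ.+ (Y ℚ.+ 0ℚ)
    lower-eq = solve 4 (λ p Y Z H → (p :+ Y) :- (Z :+ H) :+ (Z :+ H) := p :+ (Y :+ con 0ℚ)) refl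
    upper-eq : ∀ p Y Z H → p ℚ.+ H ℚ.+ Y ≡ (p ℚ.+ Y) ℚ.+ (Z ℚ.+ H) ℚ.+ ℚ.- Z
    upper-eq = solve 4 (λ p Y Z H → p :+ H :+ Y := (p :+ Y) :+ (Z :+ H) :+ :- Z) refl
    lower : point w t r j ℚ.- radius ℚ.≤ point w s r j
    lower = subst (λ p → p ℚ.- radius ℚ.≤ point w s r j) (sym (point-shift w s t r j))
      (≤-from _ _ (ℚ.+-mono-≤ (proj₂ bounds) (ℚ.+-mono-≤ 0≤h 0≤h))
        (lower-eq (point w s r j) (V r j ℚ.* X) (ν K ℚ.* h) (h ℚ.+ h)))
    upper : point w s r j ℚ.+ (h ℚ.+ h) ℚ.≤ point w t r j ℚ.+ radius
    upper = subst (λ p → point w s r j ℚ.+ (h ℚ.+ h) ℚ.≤ p ℚ.+ radius) (sym (point-shift w s t r j))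
      (≤-from _ _ (proj₁ bounds) (upper-eq (point w s r j) (V r j ℚ.* X) (ν K ℚ.* h) (h ℚ.+ h)))

  -- The space has dimension `suc k * suc κ`, which is `suc d`. A line is given by its offsets at
  -- the `d` coordinates other than the pivot, each between 0 and `3N`.
  d width₀ count : ℕ
  d      = κ ℕ.+ k ℕ.* suc κ
  width₀ = suc (N ℕ.+ N ℕ.+ N)
  count  = width₀ ℕ.^ d

  p₀ : Fin (suc d)
  p₀ = Fin.combine {suc k} {suc κ} (suc i₀) j₀

  -- The digits of the number of a line in base `width₀` are its offsets. At the pivot the shifted
  -- offset `N` is inserted, which stands for 0.
  decode : Fin count → Index
  decode i r j = insertAt (toℕ ∘ Fin.finToFun {width₀} {d} i) p₀ N (Fin.combine r j)

  flat : Index → Fin (suc d) → ℕ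
  flat w x = let r , j = Fin.remQuot {suc k} (suc κ) x in w r j

  flat-combine : ∀ w r j → flat w (Fin.combine r j) ≡ w r j
  flat-combine w r j = cong (λ (r , j) → w r j) (Fin.remQuot-combine r j)

  encode : (w : Index) → (∀ r j → w r j ℕ.≤ N ℕ.+ N ℕ.+ N) → Fin count
  encode w w≤ = Fin.funToFin {d} {width₀} (λ x → fromℕ< {removeAt (flat w) p₀ x} (ℕ.s≤s (w≤ _ _)))

  decode-encode : ∀ w w≤ → w (suc i₀) j₀ ≡ N → ∀ r j → decode (encode w w≤) r j ≡ w r j
  decode-encode w w≤ w₀≡N r j = begin
    insertAt (toℕ ∘ Fin.finToFun {width₀} {d} (encode w w≤)) p₀ N (Fin.combine r j)
      ≡⟨ insertAt-cong (λ x → trans (cong toℕ (Fin.finToFun-funToFin {d} {width₀} _ x)) (Fin.toℕ-fromℕ< _)) p₀ N (Fin.combine r j) ⟩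
    insertAt (removeAt (flat w) p₀) p₀ N (Fin.combine r j)
      ≡⟨ cong (λ n → insertAt (removeAt (flat w) p₀) p₀ n (Fin.combine r j)) (trans (flat-combine w (suc i₀) j₀) w₀≡N) ⟨
    insertAt (removeAt (flat w) p₀) p₀ (flat w p₀) (Fin.combine r j)
      ≡⟨ insertAt-removeAt (flat w) p₀ (Fin.combine r j) ⟩
    flat w (Fin.combine r j)
      ≡⟨ flat-combine w r j ⟩
    w r j ∎
    where open ≡-Reasoning

  line-box : ∀ n → Dec (n ℕ.< count) → Maybe (Box k)
  line-box n (yes n<) = just (box (decode (fromℕ< n<)))
  line-box n (no _)   = nothing

  cover : BoxSequence k
  cover n = line-box n (n ℕ.<? count)

  coordinate-bounds : ∀ (M : Chain k) r j → 0ℝ ⊑ coordinate M r j × coordinate M r j ⊑ 1ℝ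
  coordinate-bounds M zero    j = 0≤prob (initial M) (suc j) , prob≤1 (initial M) (suc j)
  coordinate-bounds M (suc i) j = 0≤prob (transition M i) (suc j) , prob≤1 (transition M i) (suc j)

  -- All coordinates of `M` are rounded to the grid. The rounded pivot coordinate determines the
  -- parameter `s`, and the other rounded coordinates then determine the offsets.
  line-through : ∀ M → ∃[ i ] ∃[ s ] s ℕ.≤ N ℕ.+ N × Near (decode i) s M
  line-through M = encode w w≤ , s , s≤2N , λ r j →
    let _ , _ , below , above = rounding r j
    in subst (λ p → fromℚ p ⊑ coordinate M r j) (sym (on-grid r j)) below ,
       subst (λ p → coordinate M r j ⊑ fromℚ (p ℚ.+ (h ℚ.+ h))) (sym (on-grid r j)) above
    where
    1≤ : 1ℚ ℚ.≤ ν (suc N) ℚ.* h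
    1≤ = ≤-from _ _ 0≤h (trans (cong (ℚ._+ h) (sym Nh≡1)) (regroup (ν N) h))
      where
      open +-*-Solver
      regroup : ∀ n h → n ℚ.* h ℚ.+ h ≡ (1ℚ ℚ.+ n) ℚ.* h ℚ.+ 0ℚ
      regroup = solve 2 (λ n h → n :* h :+ h := (con 1ℚ :+ n) :* h :+ con 0ℚ) refl
    rounding : ∀ r j → ∃[ g ] g ℕ.≤ N × fromℚ (ν g ℚ.* h) ⊑ coordinate M r j
                                      × coordinate M r j ⊑ fromℚ (ν g ℚ.* h ℚ.+ (h ℚ.+ h))
    rounding r j = grid-point 0<h N (coordinate M r j) (proj₁ (coordinate-bounds M r j))
      (≤ˢ-trans (proj₂ (coordinate-bounds M r j)) (fromℚ-mono 1≤))
    g : Index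
    g r j = proj₁ (rounding r j)
    g≤N : ∀ r j → g r j ℕ.≤ N
    g≤N r j = proj₁ (proj₂ (rounding r j))
    parameter : ∃[ s ] s ℕ.≤ N ℕ.+ N × V (suc i₀) j₀ ℚ.* (ν s ℚ.- ν N) ≡ ν (g (suc i₀) j₀)
    parameter = pivot-parameter pivot (g≤N (suc i₀) j₀)
    s : ℕ
    s = proj₁ parameter
    s≤2N : s ℕ.≤ N ℕ.+ N
    s≤2N = proj₁ (proj₂ parameter)
    offset : ∀ r j → Dec (r ≡ suc i₀) → Dec (j ≡ j₀) →
             ∃[ w ] w ℕ.≤ N ℕ.+ N ℕ.+ N × ν w ℚ.- ν N ℚ.+ V r j ℚ.* (ν s ℚ.- ν N) ≡ ν (g r j)
    -- The pivot needs exactly the offset that `decode` inserts.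
    offset r j (yes refl) (yes refl) = N , ℕ.m≤n+m N (N ℕ.+ N) ,
      trans (cong (ℚ._+ V r j ℚ.* (ν s ℚ.- ν N)) (ℚ.+-inverseʳ (ν N)))
        (trans (ℚ.+-identityˡ _) (proj₂ (proj₂ parameter)))
    offset r j (yes _) (no _)  = line-offset (V-trit r j) (g≤N r j) s≤2N
    offset r j (no _)  _       = line-offset (V-trit r j) (g≤N r j) s≤2N
    offset-pivot : ∀ a b → proj₁ (offset (suc i₀) j₀ a b) ≡ N
    offset-pivot (yes refl) (yes refl) = refl
    offset-pivot (yes _) (no ¬p) = ⊥-elim (¬p refl)
    offset-pivot (no ¬p) _       = ⊥-elim (¬p refl)
    w : Index
    w r j = proj₁ (offset r j (r Fin.≟ suc i₀) (j Fin.≟ j₀))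
    w≤ : ∀ r j → w r j ℕ.≤ N ℕ.+ N ℕ.+ N
    w≤ r j = proj₁ (proj₂ (offset r j (r Fin.≟ suc i₀) (j Fin.≟ j₀)))
    on-grid : ∀ r j → point (decode (encode w w≤)) s r j ≡ ν (g r j) ℚ.* h
    on-grid r j = cong (ℚ._* h) (trans
      (cong (λ n → ν n ℚ.- ν N ℚ.+ V r j ℚ.* (ν s ℚ.- ν N))
        (decode-encode w w≤ (offset-pivot (suc i₀ Fin.≟ suc i₀) (j₀ Fin.≟ j₀)) r j))
      (proj₂ (proj₂ (offset r j (r Fin.≟ suc i₀) (j Fin.≟ j₀)))))

  cover-covers : ∀ M → Indistinct (x₁ ∷ X₁) (x₂ ∷ X₂) M → ∃[ n ] Maybe.Any (M ∈Box_) (cover n)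
  cover-covers M ind =
    let i , s , s≤2N , near = line-through M
    in toℕ i , in-line-box i (toℕ i ℕ.<? count) (∈box {decode i} {s} {M} s≤2N near ind)
    where
    in-line-box : ∀ i (dec : Dec (toℕ i ℕ.< count)) → M ∈Box box (decode i) → Maybe.Any (M ∈Box_) (line-box (toℕ i) dec)
    in-line-box i (yes i<) M∈ = just (subst (λ i → M ∈Box box (decode i)) (sym (Fin.fromℕ<-toℕ i i<)) M∈)
    in-line-box i (no i≮)  M∈ = ⊥-elim (i≮ (Fin.toℕ<n i))

  diameter : ℚ
  diameter = ν (2 ℕ.+ K) ℚ.+ ν (2 ℕ.+ K)

  -- There are `(3N + 1)^d` boxes of side `h * diameter` in dimension `d + 1`. Each factor `3N + 1`
  -- is paired with one factor `h`, and `(3N + 1) h = 3 + h` is at most 4; a single `h` remains.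
  total-volume : h ℚ.≤ 1ℚ → ∀ {ε} → diameter ℚ.* (ν 4 ℚ.* diameter) ^ d ℚ.* h ℚ.≤ ε → TotalVolume≤ cover ε
  total-volume h≤1 {ε} bound n = ℚ.≤-trans
    (sum-bounded (λ i → maybe′ volume 0ℚ (cover i)) count 0≤vol
      (λ i → volume≤ i (i ℕ.<? count)) (λ i count≤i → outside i (i ℕ.<? count) count≤i) n)
    (ℚ.≤-trans estimate bound)
    where
    open +-*-Solver
    W vol : ℚ
    W   = radius ℚ.+ radius
    vol = W ^ (suc κ ℕ.* suc k)
    0≤W : 0ℚ ℚ.≤ W
    0≤W = ℚ.+-mono-≤ 0≤radius 0≤radius
    0≤vol : 0ℚ ℚ.≤ vol
    0≤vol = 0≤^ (suc κ ℕ.* suc k) 0≤W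
    volume≤ : ∀ i dec → maybe′ volume 0ℚ (line-box i dec) ℚ.≤ vol
    volume≤ i (yes i<) = ℚ.≤-reflexive (volume-box (decode (fromℕ< i<)))
    volume≤ i (no _)   = 0≤vol
    outside : ∀ i dec → count ℕ.≤ i → maybe′ volume 0ℚ (line-box i dec) ≡ 0ℚ
    outside i (yes i<) count≤i = ⊥-elim (ℕ.<⇒≱ i< count≤i)
    outside i (no _)   _       = refl
    0≤D : 0ℚ ℚ.≤ diameter
    0≤D = ℚ.+-mono-≤ (0≤ν (2 ℕ.+ K)) (0≤ν (2 ℕ.+ K))
    W-eq : W ≡ h ℚ.* diameter
    W-eq = eq (ν K) h
      where
      eq : ∀ K h → (K ℚ.* h ℚ.+ (h ℚ.+ h)) ℚ.+ (K ℚ.* h ℚ.+ (h ℚ.+ h)) ≡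
                   h ℚ.* ((1ℚ ℚ.+ (1ℚ ℚ.+ K)) ℚ.+ (1ℚ ℚ.+ (1ℚ ℚ.+ K)))
      eq = solve 2 (λ K h → (K :* h :+ (h :+ h)) :+ (K :* h :+ (h :+ h)) :=
                   h :* ((con 1ℚ :+ (con 1ℚ :+ K)) :+ (con 1ℚ :+ (con 1ℚ :+ K)))) refl
    width₀h≤4 : ν width₀ ℚ.* h ℚ.≤ ν 4
    width₀h≤4 = subst (ℚ._≤ ν 4) (sym eq) (ℚ.+-mono-≤ h≤1 (ℚ.≤-refl {ν 3}))
      where
      regroup : ∀ n h → (1ℚ ℚ.+ (n ℚ.+ n ℚ.+ n)) ℚ.* h ≡ h ℚ.+ (n ℚ.* h ℚ.+ (n ℚ.* h ℚ.+ (n ℚ.* h ℚ.+ 0ℚ)))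
      regroup = solve 2 (λ n h → (con 1ℚ :+ (n :+ n :+ n)) :* h := h :+ (n :* h :+ (n :* h :+ (n :* h :+ con 0ℚ)))) refl
      eq : ν width₀ ℚ.* h ≡ h ℚ.+ ν 3
      eq = trans (cong (λ x → (1ℚ ℚ.+ x) ℚ.* h) (trans (ν-+ (N ℕ.+ N) N) (cong (ℚ._+ ν N) (ν-+ N N))))
        (trans (regroup (ν N) h) (cong (λ x → h ℚ.+ (x ℚ.+ (x ℚ.+ (x ℚ.+ 0ℚ)))) Nh≡1))
    estimate : ν count ℚ.* vol ℚ.≤ diameter ℚ.* (ν 4 ℚ.* diameter) ^ d ℚ.* h
    estimate = begin
      ν count ℚ.* vol
        ≡⟨ cong₂ ℚ._*_ (ν-^ width₀ d) (cong (W ^_) (ℕ.*-comm (suc κ) (suc k))) ⟩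
      ν width₀ ^ d ℚ.* (W ℚ.* W ^ d)
        ≡⟨ rearrange₁ (ν width₀ ^ d) W (W ^ d) ⟩
      W ℚ.* (ν width₀ ^ d ℚ.* W ^ d)
        ≡⟨ cong (W ℚ.*_) (^-distrib-* (ν width₀) W d) ⟨
      W ℚ.* (ν width₀ ℚ.* W) ^ d
        ≤⟨ *-monoˡ-≤ 0≤W (^-mono-≤ d (0≤* (0≤ν width₀) 0≤W) width₀W≤) ⟩
      W ℚ.* (ν 4 ℚ.* diameter) ^ d
        ≡⟨ cong (ℚ._* (ν 4 ℚ.* diameter) ^ d) W-eq ⟩
      h ℚ.* diameter ℚ.* (ν 4 ℚ.* diameter) ^ d
        ≡⟨ rearrange₂ h diameter ((ν 4 ℚ.* diameter) ^ d) ⟩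
      diameter ℚ.* (ν 4 ℚ.* diameter) ^ d ℚ.* h ∎
      where
      open ℚ.≤-Reasoning
      rearrange₁ : ∀ a b c → a ℚ.* (b ℚ.* c) ≡ b ℚ.* (a ℚ.* c)
      rearrange₁ = solve 3 (λ a b c → a :* (b :* c) := b :* (a :* c)) refl
      rearrange₂ : ∀ a b c → a ℚ.* b ℚ.* c ≡ b ℚ.* c ℚ.* a
      rearrange₂ = solve 3 (λ a b c → a :* b :* c := b :* c :* a) refl
      width₀W≤ : ν width₀ ℚ.* W ℚ.≤ ν 4 ℚ.* diameter
      width₀W≤ = subst₂ ℚ._≤_
        (trans (ℚ.*-comm diameter (ν width₀ ℚ.* h)) (trans (ℚ.*-assoc (ν width₀) h diameter) (cong (ν width₀ ℚ.*_) (sym W-eq))))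
        (ℚ.*-comm diameter (ν 4)) (*-monoˡ-≤ 0≤D width₀h≤4)

nullset : ∀ {κ} (dir : Direction (suc (suc κ))) x₁ X₁ x₂ X₂ →
  (∀ e → e ∈ x₁ ∷ X₁ → velocity dir (proj₁ e) (proj₂ e) ≡ 1ℚ) →
  (∀ e → e ∈ x₂ ∷ X₂ → velocity dir (proj₁ e) (proj₂ e) ≡ ℚ.- 1ℚ) →
  ∀ i j → velocity dir i (suc j) ≡ 1ℚ ⊎ velocity dir i (suc j) ≡ ℚ.- 1ℚ →
  ∀ {ε} → 0ℚ ℚ.< ε →
  ∃[ c ] Covers c (Indistinct (x₁ ∷ X₁) (x₂ ∷ X₂)) × TotalVolume≤ c ε
nullset {κ} dir x₁ X₁ x₂ X₂ up down i j pivot {ε} 0<ε =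
  cover , cover-covers , total-volume h≤1 bound
  where
  K : ℕ
  K = suc (suc κ ℕ.+ suc κ)
  D X : ℚ
  D = ν (2 ℕ.+ K) ℚ.+ ν (2 ℕ.+ K)
  -- The factor of `h` in the bound of `total-volume`. It depends on `κ` alone, so the mesh can be
  -- chosen after it.
  X = D ℚ.* (ν 4 ℚ.* D) ^ (κ ℕ.+ suc (suc κ) ℕ.* suc κ)
  1/ε : ∃[ r ] 0ℚ ℚ.< r × ε ℚ.* r ≡ 1ℚ
  1/ε = reciprocal 0<ε
  large : ∃[ n ] X ℚ.* proj₁ 1/ε ℚ.≤ ν n
  large = archimedean (X ℚ.* proj₁ 1/ε)
  N : ℕ
  N = suc (proj₁ large)
  1/N : ∃[ h ] 0ℚ ℚ.< h × ν N ℚ.* h ≡ 1ℚ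
  1/N = reciprocal (0<ν (proj₁ large))
  h : ℚ
  h = proj₁ 1/N
  0<h : 0ℚ ℚ.< h
  0<h = proj₁ (proj₂ 1/N)
  Nh≡1 : ν N ℚ.* h ≡ 1ℚ
  Nh≡1 = proj₂ (proj₂ 1/N)
  open LineCover dir h 0<h N Nh≡1 x₁ X₁ x₂ X₂ up down i j pivot using (cover; cover-covers; total-volume)
  h≤1 : h ℚ.≤ 1ℚ
  h≤1 = subst₂ ℚ._≤_ (trans (cong (h ℚ.*_) (ℚ.+-identityʳ 1ℚ)) (ℚ.*-identityʳ h)) (trans (ℚ.*-comm h (ν N)) Nh≡1)
    (*-monoˡ-≤ (ℚ.<⇒≤ 0<h) (ν-mono {1} {N} (ℕ.s≤s ℕ.z≤n)))
  -- X h = ε (h (X/ε)) ≤ ε (h N) = ε.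
  bound : X ℚ.* h ℚ.≤ ε
  bound = subst₂ ℚ._≤_
    (trans (regroup ε h X (proj₁ 1/ε)) (trans (cong (ℚ._* (X ℚ.* h)) (proj₂ (proj₂ 1/ε))) (ℚ.*-identityˡ _)))
    (trans (cong (ε ℚ.*_) (trans (ℚ.*-comm h (ν N)) Nh≡1)) (ℚ.*-identityʳ ε))
    (*-monoˡ-≤ (ℚ.<⇒≤ 0<ε) (*-monoˡ-≤ (ℚ.<⇒≤ 0<h)
      (ℚ.≤-trans (proj₂ large) (ν-mono (ℕ.n≤1+n (proj₁ large))))))
    where
    open +-*-Solver
    regroup : ∀ ε h X r → ε ℚ.* (h ℚ.* (X ℚ.* r)) ≡ ε ℚ.* r ℚ.* (X ℚ.* h)
    regroup = solve 4 (λ ε h X r → ε :* (h :* (X :* r)) := ε :* r :* (X :* h)) refl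

-- Lists without repetitions and the pigeonhole principle

∉-from-All : ∀ {A : Set} {x : A} {xs} → All (x ≢_) xs → x ∉ xs
∉-from-All x∉ x∈ = All.lookup x∉ x∈ refl

lookup-∈ : ∀ {A : Set} (xs : List A) i → List.lookup xs i ∈ xs
lookup-∈ (x ∷ xs) zero    = here refl
lookup-∈ (x ∷ xs) (suc i) = there (lookup-∈ xs i)

lookup-injective : ∀ {A : Set} {xs : List A} → Unique xs → ∀ {i j} → List.lookup xs i ≡ List.lookup xs j → i ≡ j
lookup-injective (x∉ ∷ u) {zero}  {zero}  eq = refl
lookup-injective (x∉ ∷ u) {zero}  {suc j} eq = ⊥-elim (All.lookup x∉ (lookup-∈ _ j) eq)
lookup-injective (x∉ ∷ u) {suc i} {zero}  eq = ⊥-elim (All.lookup x∉ (lookup-∈ _ i) (sym eq))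
lookup-injective (x∉ ∷ u) {suc i} {suc j} eq = cong suc (lookup-injective u eq)

Unique-length-≤ : ∀ {k} {xs : List (Fin k)} → Unique xs → length xs ℕ.≤ k
Unique-length-≤ u = Fin.injective⇒≤ (lookup-injective u)

module _ {A : Set} {P : A → Set} (P? : ∀ x → Dec (P x)) where

  filter-↭-partition : ∀ xs → xs ↭ List.filter P? xs ++ List.filter (¬? ∘ P?) xs
  filter-↭-partition [] = ↭-refl
  filter-↭-partition (x ∷ xs) with P? x
  ... | yes _ = Perm.prep x (filter-↭-partition xs)
  ... | no  _ = ↭-trans (Perm.prep x (filter-↭-partition xs))
                        (↭-sym (Perm.shift x (List.filter P? xs) (List.filter (¬? ∘ P?) xs)))

-- Induction on the number of values: if the largest value is taken at most `m` times, discarding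
-- its occurrences leaves more than `m * k` elements for the remaining `k` values.
pigeonhole : ∀ {A : Set} (f : A → ℕ) k m (xs : List A) → All (λ x → f x ℕ.< k) xs → m ℕ.* k ℕ.< length xs →
             ∃[ p ] m ℕ.< length (List.filter (λ x → f x ℕ.≟ p) xs)
pigeonhole f zero    m []       f<k lt = ⊥-elim (ℕ.n≮0 lt)
pigeonhole f zero    m (x ∷ xs) (() ∷ _) lt
pigeonhole f (suc k) m xs f<k lt with m ℕ.<? length (List.filter (λ x → f x ℕ.≟ k) xs)
... | yes m< = k , m<
... | no  m≮ =
  let p , m< = pigeonhole f k m rest rest<k (ℕ.+-cancelˡ-< m (m ℕ.* k) (length rest) (begin-strict
        m ℕ.+ m ℕ.* k                        ≡⟨ ℕ.*-suc m k ⟨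
        m ℕ.* suc k                          <⟨ lt ⟩
        length xs                            ≡⟨ Perm.↭-length (filter-↭-partition f≟k xs) ⟩
        length (List.filter f≟k xs ++ rest)  ≡⟨ List.length-++ (List.filter f≟k xs) ⟩
        length (List.filter f≟k xs) ℕ.+ length rest ≤⟨ ℕ.+-monoˡ-≤ _ (ℕ.≮⇒≥ m≮) ⟩
        m ℕ.+ length rest                    ∎))
  in p , ℕ.≤-trans m< (filter-sub p)
  where
  open ℕ.≤-Reasoning
  f≟k : ∀ x → Dec (f x ≡ k)
  f≟k x = f x ℕ.≟ k
  rest = List.filter (¬? ∘ f≟k) xs
  rest<k : All (λ x → f x ℕ.< k) rest
  rest<k = All.zipWith (λ (f< , f≢) → ℕ.≤∧≢⇒< (ℕ.<⇒≤pred f<) f≢)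
    (All.filter⁺ (¬? ∘ f≟k) f<k , All.all-filter (¬? ∘ f≟k) xs)
  filter-sub : ∀ p → length (List.filter (λ x → f x ℕ.≟ p) rest) ℕ.≤ length (List.filter (λ x → f x ℕ.≟ p) xs)
  filter-sub p = begin
    length (F rest)                                ≤⟨ ℕ.m≤n+m _ (length (F (List.filter f≟k xs))) ⟩
    length (F (List.filter f≟k xs)) ℕ.+ length (F rest) ≡⟨ List.length-++ (F (List.filter f≟k xs)) ⟨
    length (F (List.filter f≟k xs) ++ F rest)      ≡⟨ cong length (List.filter-++ (λ x → f x ℕ.≟ p) (List.filter f≟k xs) rest) ⟨
    length (F (List.filter f≟k xs ++ rest))        ≡⟨ Perm.↭-length (Perm.filter-↭ (λ x → f x ℕ.≟ p) (filter-↭-partition f≟k xs)) ⟨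
    length (F xs)                                  ∎
    where F = List.filter (λ x → f x ℕ.≟ p)

ones : ∀ q → Vec ℕ q
ones q = Vec.replicate q 1

-- Walks

Edge : ℕ → Set
Edge k = Fin k × Fin k

infixr 5 _∷_

-- Any two states may follow each other. Keeping both ends in the type lets closed walks be iterated
-- or removed with the rest of the walk still fitting.
data Walk {k : ℕ} : Fin k → Fin k → Set where
  []  : ∀ {i} → Walk i i
  _∷_ : ∀ i {j l} → Walk j l → Walk i l

module _ {k : ℕ} where

  edges : ∀ {i l : Fin k} → Walk i l → List (Edge k)
  edges []              = []
  edges (_∷_ i {j} w) = (i , j) ∷ edges w

  size : ∀ {i l : Fin k} → Walk i l → ℕ
  size w = length (edges w)

  sources : ∀ {i l : Fin k} → Walk i l → List (Fin k)
  sources []      = []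
  sources (i ∷ w) = i ∷ sources w

  vertices : ∀ {i l : Fin k} → Walk i l → List (Fin k)
  vertices {i} []  = i ∷ []
  vertices (i ∷ w) = i ∷ vertices w

  infixr 5 _⧺_

  _⧺_ : ∀ {i j l : Fin k} → Walk i j → Walk j l → Walk i l
  []      ⧺ w = w
  (i ∷ v) ⧺ w = i ∷ (v ⧺ w)

  power : ∀ {u : Fin k} → Walk u u → ℕ → Walk u u
  power c zero    = []
  power c (suc n) = c ⧺ power c n

  -- Positions beyond the end return the final state.
  at : ∀ {i l : Fin k} → Walk i l → ℕ → Fin k
  at {i} []  n       = i
  at (i ∷ w) zero    = i
  at (i ∷ w) (suc n) = at w n

  edges-⧺ : ∀ {i j l : Fin k} (v : Walk i j) (w : Walk j l) → edges (v ⧺ w) ≡ edges v ++ edges w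
  edges-⧺ []      w = refl
  edges-⧺ (i ∷ v) w = cong (_ ∷_) (edges-⧺ v w)

  size-⧺ : ∀ {i j l : Fin k} (v : Walk i j) (w : Walk j l) → size (v ⧺ w) ≡ size v ℕ.+ size w
  size-⧺ v w = trans (cong length (edges-⧺ v w)) (List.length-++ (edges v))

  ⧺-assoc : ∀ {i j l m : Fin k} (u : Walk i j) (v : Walk j l) (w : Walk l m) → (u ⧺ v) ⧺ w ≡ u ⧺ (v ⧺ w)
  ⧺-assoc []      v w = refl
  ⧺-assoc (i ∷ u) v w = cong (i ∷_) (⧺-assoc u v w)

  size-sources : ∀ {i l : Fin k} (w : Walk i l) → size w ≡ length (sources w)
  size-sources []      = refl
  size-sources (i ∷ w) = cong suc (size-sources w)

  size-vertices : ∀ {i l : Fin k} (w : Walk i l) → suc (size w) ≡ length (vertices w)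
  size-vertices []      = refl
  size-vertices (i ∷ w) = cong suc (size-vertices w)

  sources⊆vertices : ∀ {i l : Fin k} (w : Walk i l) {x} → x ∈ sources w → x ∈ vertices w
  sources⊆vertices (i ∷ w) (here eq)  = here eq
  sources⊆vertices (i ∷ w) (there x∈) = there (sources⊆vertices w x∈)

  sources-edges : ∀ {i l : Fin k} (w : Walk i l) → sources w ≡ List.map proj₁ (edges w)
  sources-edges []      = refl
  sources-edges (i ∷ w) = cong (i ∷_) (sources-edges w)

  -- The sources list the states of a closed walk without counting the return to `u`.
  Simple : ∀ {u : Fin k} → Walk u u → Set
  Simple c = Unique (sources c) × 1 ℕ.≤ size c

  size-simple : ∀ {u : Fin k} {c : Walk u u} → Simple c → size c ℕ.≤ k
  size-simple {c = c} (u , _) = subst (ℕ._≤ k) (sym (size-sources c)) (Unique-length-≤ u)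

  split-walk : ∀ n {i l : Fin k} (w : Walk i l) → n ℕ.≤ size w →
    ∃[ j ] ∃[ u ] ∃[ v ] edges w ≡ edges {i} {j} u ++ edges {j} {l} v × size u ≡ n
  split-walk zero    w n≤ = _ , [] , w , refl , refl
  split-walk (suc n) (i ∷ w) (ℕ.s≤s n≤) =
    let j , u , v , eq , sz = split-walk n w n≤ in j , i ∷ u , v , cong (_ ∷_) eq , cong suc sz

  -- The piece up to `i` becomes a simple cycle once an edge from `i` to `j` is put in front, whence
  -- `Unique (i ∷ sources u)`. The inclusion of its sources in the vertices carries the induction.
  split-at-vertex : ∀ {i j l : Fin k} (w : Walk j l) → Unique (vertices w) → i ∈ vertices w →
    ∃[ u ] ∃[ v ] edges w ≡ edges {j} {i} u ++ edges {i} {l} v × Unique (i ∷ sources u) ×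
                  (∀ {x} → x ∈ sources u → x ∈ vertices w)
  split-at-vertex []      _ (here refl) = [] , [] , refl , ([] ∷ []) , λ ()
  split-at-vertex (j ∷ w) _ (here refl) = [] , (j ∷ w) , refl , ([] ∷ []) , λ ()
  split-at-vertex {i} (j ∷ w) (j∉ ∷ uniq) (there i∈) with split-at-vertex w uniq i∈
  ... | u , v , eq , (i∉ ∷ uniq′) , sub =
    j ∷ u , v , cong (_ ∷_) eq ,
    (((λ i≡j → ∉-from-All j∉ (subst (_∈ vertices w) i≡j i∈)) ∷ i∉) ∷
     (All.tabulate (λ x∈ j≡x → ∉-from-All j∉ (subst (_∈ vertices w) (sym j≡x) (sub x∈))) ∷ uniq′)) ,
    λ { (here eq) → here eq ; (there x∈) → there (sub x∈) }

  Has-cycle : ∀ {i l : Fin k} → Walk i l → Set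
  Has-cycle {i} {l} w = ∃[ u ] ∃[ a ] ∃[ c ] ∃[ b ]
    edges w ≡ edges {i} {u} a ++ edges {u} {u} c ++ edges {u} {l} b × Simple c

  -- The walk is built up from its end: the first new state that occurs already in the
  -- repetition-free tail closes a simple cycle.
  find-cycle : ∀ {i l : Fin k} (w : Walk i l) → Unique (vertices w) ⊎ Has-cycle w
  find-cycle [] = inj₁ ([] ∷ [])
  find-cycle (i ∷ w) with find-cycle w
  ... | inj₂ (u , a , c , b , eq , simple) = inj₂ (u , i ∷ a , c , b , cong (_ ∷_) eq , simple)
  ... | inj₁ uniq with any? (i Fin.≟_) (vertices w)
  ...   | yes i∈ = let u , v , eq , uniq′ , _ = split-at-vertex w uniq i∈
                   in inj₂ (i , [] , i ∷ u , v , cong (_ ∷_) eq , uniq′ , ℕ.s≤s ℕ.z≤n)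
  ...   | no  i∉ = inj₁ (All.¬Any⇒All¬ (vertices w) i∉ ∷ uniq)

  -- A walk with at least `k` transitions visits more than `k` states, counted with repetition.
  long⇒cycle : ∀ {i l : Fin k} (w : Walk i l) → k ℕ.≤ size w → Has-cycle w
  long⇒cycle w k≤ with find-cycle w
  ... | inj₂ cycle = cycle
  ... | inj₁ uniq  = ⊥-elim (ℕ.<⇒≱ (subst (k ℕ.<_) (size-vertices w) (ℕ.s≤s k≤)) (Unique-length-≤ uniq))

  -- Walks strung with simple cycles

  data Beads (l : Fin k) : ℕ → Fin k → Set where
    end  : ∀ {i} → Walk i l → Beads l 0 i
    bead : ∀ {q i u} → Walk i u → (c : Walk u u) → Simple c → Beads l q u → Beads l (suc q) i

  -- The vector tells how often each bead is traversed: `ones q` recovers the walk that was cut up,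
  -- 0 deletes a cycle and 2 doubles it.
  thread : ∀ {l q i} → Beads l q i → Vec ℕ q → Walk i l
  thread (end w)        []       = w
  thread (bead a c _ B) (n ∷ ns) = a ⧺ (power c n ⧺ thread B ns)

  record Located {l q i} (B : Beads l q i) (x : Fin q) : Set where
    constructor located
    field
      {base}  : Fin k
      cycle   : Walk base base
      simple  : Simple cycle
      around  : ∀ ns → ∃[ a ] ∃[ b ] thread B ns ≡ a ⧺ (power cycle (lookup ns x) ⧺ b)

  locate : ∀ {l q i} (B : Beads l q i) x → Located B x
  locate (bead a c s B) zero    = located c s λ { (n ∷ ns) → a , thread B ns , refl }
  locate (bead a c s B) (suc x) = located (Located.cycle L) (Located.simple L) λ { (n ∷ ns) →
    let a′ , b , eq = Located.around L ns
    in a ⧺ (power c n ⧺ a′) , b , trans (cong (λ w → a ⧺ (power c n ⧺ w)) eq)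
         (trans (cong (a ⧺_) (sym (⧺-assoc (power c n) a′ _))) (sym (⧺-assoc a _ _))) }
    where L = locate B x

  loop : ∀ {l q i} (B : Beads l q i) → Fin q → List (Edge k)
  loop B x = edges (Located.cycle (locate B x))

  repeat : ℕ → List (Edge k) → List (Edge k)
  repeat n es = List.concat (List.replicate n es)

  edges-power : ∀ {u : Fin k} (c : Walk u u) n → edges (power c n) ≡ repeat n (edges c)
  edges-power c zero    = refl
  edges-power c (suc n) = trans (edges-⧺ c (power c n)) (cong (edges c ++_) (edges-power c n))

  edges-thread : ∀ {l q i u} (a : Walk i u) (c : Walk u u) s (B : Beads l q u) n ns →
    edges (thread (bead a c s B) (n ∷ ns)) ≡ edges a ++ repeat n (edges c) ++ edges (thread B ns)
  edges-thread a c s B n ns = trans (edges-⧺ a _) (cong (edges a ++_)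
    (trans (edges-⧺ (power c n) _) (cong (_++ edges (thread B ns)) (edges-power c n))))

  -- A closed walk can be repeated or skipped without affecting the rest, so up to order a bead
  -- contributes just the copies of its loop.
  thread-update : ∀ {l q i} (B : Beads l q i) ns x n →
    edges (thread B (ns [ x ]≔ n)) ↭ repeat n (loop B x) ++ edges (thread B (ns [ x ]≔ 0))
  thread-update (bead a c s B) (n₀ ∷ ns) zero n = begin
    edges (thread (bead a c s B) (n ∷ ns))                    ≡⟨ edges-thread a c s B n ns ⟩
    edges a ++ repeat n (edges c) ++ edges (thread B ns)      ↭⟨ Perm.shifts (edges a) (repeat n (edges c)) ⟩
    repeat n (edges c) ++ edges a ++ edges (thread B ns)      ≡⟨ cong (repeat n (edges c) ++_) (edges-thread a c s B 0 ns) ⟨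
    repeat n (edges c) ++ edges (thread (bead a c s B) (0 ∷ ns)) ∎
    where open Perm.PermutationReasoning
  thread-update (bead a c s B) (n₀ ∷ ns) (suc x) n = begin
    edges (thread (bead a c s B) (n₀ ∷ (ns [ x ]≔ n)))  ≡⟨ edges-thread a c s B n₀ _ ⟩
    A ++ C ++ edges (thread B (ns [ x ]≔ n))            ↭⟨ Perm.++⁺ˡ A (Perm.++⁺ˡ C (thread-update B ns x n)) ⟩
    A ++ C ++ R ++ T                                    ↭⟨ Perm.++⁺ˡ A (Perm.shifts C R) ⟩
    A ++ R ++ C ++ T                                    ↭⟨ Perm.shifts A R ⟩
    R ++ A ++ C ++ T                                    ≡⟨ cong (R ++_) (edges-thread a c s B n₀ _) ⟨
    R ++ edges (thread (bead a c s B) (n₀ ∷ (ns [ x ]≔ 0))) ∎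
    where
    open Perm.PermutationReasoning
    A = edges a
    C = repeat n₀ (edges c)
    R = repeat n (loop B x)
    T = edges (thread B (ns [ x ]≔ 0))

  thread-update₂ : ∀ {l q i} (B : Beads l q i) ns {x y} → x ≢ y → ∀ m n →
    edges (thread B ((ns [ x ]≔ m) [ y ]≔ n)) ↭
    repeat m (loop B x) ++ repeat n (loop B y) ++ edges (thread B ((ns [ x ]≔ 0) [ y ]≔ 0))
  thread-update₂ B ns {x} {y} x≢y m n = begin
    edges (thread B ((ns [ x ]≔ m) [ y ]≔ n))      ↭⟨ thread-update B (ns [ x ]≔ m) y n ⟩
    Y ++ edges (thread B ((ns [ x ]≔ m) [ y ]≔ 0)) ≡⟨ cong (λ ns → Y ++ edges (thread B ns)) (Vec.[]≔-commutes ns x y x≢y) ⟩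
    Y ++ edges (thread B ((ns [ y ]≔ 0) [ x ]≔ m)) ↭⟨ Perm.++⁺ˡ Y (thread-update B (ns [ y ]≔ 0) x m) ⟩
    Y ++ X ++ edges (thread B ((ns [ y ]≔ 0) [ x ]≔ 0)) ↭⟨ Perm.shifts Y X ⟩
    X ++ Y ++ edges (thread B ((ns [ y ]≔ 0) [ x ]≔ 0)) ≡⟨ cong (λ ns → X ++ Y ++ edges (thread B ns)) (Vec.[]≔-commutes ns x y x≢y) ⟨
    X ++ Y ++ edges (thread B ((ns [ x ]≔ 0) [ y ]≔ 0)) ∎
    where
    open Perm.PermutationReasoning
    X = repeat m (loop B x)
    Y = repeat n (loop B y)

  -- Each block of `k` transitions contains a simple cycle, which becomes a bead.
  string : ∀ q {i l : Fin k} (w : Walk i l) → q ℕ.* k ℕ.≤ size w →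
           ∃[ B ] edges (thread {l} {q} {i} B (ones q)) ≡ edges w
  string zero    w _  = end w , refl
  string (suc q) w le =
    let j , v , w′ , eq , sz = split-walk k w (ℕ.m+n≤o⇒m≤o k le)
        u , a , c , b , eq′ , simple = long⇒cycle v (ℕ.≤-reflexive (sym sz))
        size-w = trans (cong length eq) (trans (List.length-++ (edges v)) (cong (ℕ._+ size w′) sz))
        qk≤ = ℕ.+-cancelˡ-≤ k (q ℕ.* k) (size w′) (subst (k ℕ.+ q ℕ.* k ℕ.≤_) size-w le)
        -- What follows the cycle in its block is joined to the remaining walk, which only gets
        -- longer.
        B , eq″ = string q (b ⧺ w′) (ℕ.≤-trans qk≤ (subst (size w′ ℕ.≤_) (sym (size-⧺ b w′)) (ℕ.m≤n+m _ _)))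
        open ≡-Reasoning
    in bead a c simple B , (begin
    edges (thread (bead a c simple B) (ones (suc q)))     ≡⟨ edges-thread a c simple B 1 (ones q) ⟩
    edges a ++ repeat 1 (edges c) ++ edges (thread B (ones q)) ≡⟨ cong₂ (λ x y → edges a ++ x ++ y) (List.++-identityʳ (edges c)) (trans eq″ (edges-⧺ b w′)) ⟩
    edges a ++ edges c ++ edges b ++ edges w′                ≡⟨ cong (edges a ++_) (List.++-assoc (edges c) (edges b) _) ⟨
    edges a ++ (edges c ++ edges b) ++ edges w′              ≡⟨ List.++-assoc (edges a) (edges c ++ edges b) _ ⟨
    (edges a ++ edges c ++ edges b) ++ edges w′              ≡⟨ cong (_++ edges w′) eq′ ⟨
    edges v ++ edges w′                                      ≡⟨ eq ⟨
    edges w                                                  ∎)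

  -- The single traversal of each bead in `ys` is traded for one more traversal of bead `x`. The
  -- edges agree up to order because the loops do.
  gather : ∀ {l q i} (B : Beads l q i) x ys ns → Unique ys → All (x ≢_) ys →
    All (λ y → loop B y ↭ loop B x) ys → All (λ y → lookup ns y ≡ 1) ys →
    ∃[ ns′ ] lookup ns′ x ≡ length ys ℕ.+ lookup ns x × edges (thread B ns) ↭ edges (thread B ns′)
  gather B x []       ns _ _ _ _ = ns , refl , ↭-refl
  gather B x (y ∷ ys) ns (y∉ ∷ uniq) (x≢y ∷ x∉) (y↭x ∷ ys↭x) (ns-y ∷ ns-ys) =
    let ns″ , count , ↭₂ = gather B x ys ns′ uniq x∉ ys↭x
          (All.zipWith (λ (z∉ , x≢z , eq) → trans (unchanged (z∉ ∘ sym) (x≢z ∘ sym)) eq) (y∉ , All.zip (x∉ , ns-ys)))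
    in ns″ , trans count (trans (cong (length ys ℕ.+_) (Vec.lookup∘updateAt x (ns [ y ]≔ 0)))
                                (ℕ.+-suc (length ys) (lookup ns x)))
           , ↭-trans move ↭₂
    where
    n = lookup ns x
    ns′ = (ns [ y ]≔ 0) [ x ]≔ suc n
    y≢x = x≢y ∘ sym
    unchanged : ∀ {z} → z ≢ y → z ≢ x → lookup ns′ z ≡ lookup ns z
    unchanged {z} z≢y z≢x = trans (Vec.lookup∘updateAt′ z x z≢x (ns [ y ]≔ 0)) (Vec.lookup∘updateAt′ z y z≢y ns)
    R = edges (thread B ((ns [ y ]≔ 0) [ x ]≔ 0))
    same : ns ≡ (ns [ y ]≔ 1) [ x ]≔ n
    same = sym (trans (cong (λ v → (ns [ y ]≔ v) [ x ]≔ n) (sym ns-y))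
                      (trans (cong (_[ x ]≔ n) (Vec.[]≔-lookup ns y)) (Vec.[]≔-lookup ns x)))
    move : edges (thread B ns) ↭ edges (thread B ns′)
    move = begin
      edges (thread B ns)                                      ≡⟨ cong (edges ∘ thread B) same ⟩
      edges (thread B ((ns [ y ]≔ 1) [ x ]≔ n))                ↭⟨ thread-update₂ B ns y≢x 1 n ⟩
      repeat 1 (loop B y) ++ repeat n (loop B x) ++ R          ≡⟨ cong (_++ repeat n (loop B x) ++ R) (List.++-identityʳ (loop B y)) ⟩
      loop B y ++ repeat n (loop B x) ++ R                     ↭⟨ Perm.++⁺ʳ _ y↭x ⟩
      loop B x ++ repeat n (loop B x) ++ R                     ≡⟨ List.++-assoc (loop B x) (repeat n (loop B x)) R ⟨
      repeat (suc n) (loop B x) ++ R                           ↭⟨ thread-update₂ B ns y≢x 0 (suc n) ⟨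
      edges (thread B ns′)                                     ∎
      where open Perm.PermutationReasoning

  at-start : ∀ {i l : Fin k} (w : Walk i l) → at w 0 ≡ i
  at-start []      = refl
  at-start (i ∷ w) = refl

  at-left : ∀ {i j l : Fin k} (v : Walk i j) (w : Walk j l) {n} → n ℕ.< size v → at (v ⧺ w) n ≡ at v n
  at-left (i ∷ v) w {zero}  _          = refl
  at-left (i ∷ v) w {suc n} (ℕ.s≤s n<) = at-left v w n<

  at-right : ∀ {i j l : Fin k} (v : Walk i j) (w : Walk j l) n → at (v ⧺ w) (size v ℕ.+ n) ≡ at w n
  at-right []      w n = refl
  at-right (i ∷ v) w n = at-right v w n

  at-source : ∀ {i l : Fin k} (w : Walk i l) x → at w (toℕ x) ≡ List.lookup (sources w) x
  at-source (i ∷ w) zero    = refl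
  at-source (i ∷ w) (suc x) = at-source w x

  -- The last position `n * size c` is included: there `b` starts, at the base of the cycle.
  at-power : ∀ {u l : Fin k} (c : Walk u u) (b : Walk u l) .{{_ : NonZero (size c)}} n i → i ℕ.≤ n ℕ.* size c →
             at (power c n ⧺ b) i ≡ at c (i % size c)
  at-power c b zero    zero i≤ = trans (at-start b) (sym (trans (cong (at c) (0%n≡0 (size c))) (at-start c)))
    where
    0%n≡0 : ∀ n .{{_ : NonZero n}} → 0 % n ≡ 0
    0%n≡0 (suc n) = refl
  at-power c b (suc n) i i≤ with i ℕ.<? size c
  ... | yes i< = trans (cong (λ w → at w i) (⧺-assoc c (power c n) b))
                   (trans (at-left c _ i<) (cong (at c) (sym (m<n⇒m%n≡m i<))))
  ... | no  i≮ = begin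
    at ((c ⧺ power c n) ⧺ b) i          ≡⟨ cong₂ at (⧺-assoc c (power c n) b) (sym p+i′≡i) ⟩
    at (c ⧺ (power c n ⧺ b)) (p ℕ.+ i′) ≡⟨ at-right c _ i′ ⟩
    at (power c n ⧺ b) i′               ≡⟨ at-power c b n i′ (ℕ.+-cancelˡ-≤ p i′ (n ℕ.* p) (subst (ℕ._≤ p ℕ.+ n ℕ.* p) (sym p+i′≡i) i≤)) ⟩
    at c (i′ % p)                       ≡⟨ cong (at c) ([m+n]%n≡m%n i′ p) ⟨
    at c ((i′ ℕ.+ p) % p)               ≡⟨ cong (λ x → at c (x % p)) (trans (ℕ.+-comm i′ p) p+i′≡i) ⟩
    at c (i % p)                        ∎
    where
    open ≡-Reasoning
    p = size c
    i′ = i ℕ.∸ p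
    p+i′≡i : p ℕ.+ i′ ≡ i
    p+i′≡i = ℕ.m+[n∸m]≡n (ℕ.≮⇒≥ i≮)

  sequence : ∀ {i l : Fin k} → Walk i l → ∀ n → Sequence k n
  sequence w n = tabulate (λ x → at w (toℕ x))

  transitions-sequence : ∀ {i l : Fin k} (w : Walk i l) {n} → size w ≡ n → transitions (sequence w n) ≡ edges w
  transitions-sequence []      refl = refl
  transitions-sequence (i ∷ w) refl = cong₂ (λ j es → (i , j) ∷ es) (at-start w) (transitions-sequence w refl)

  walk-of : ∀ {n} (s : Sequence k n) → ∃[ l ] ∃[ w ] edges {head s} {l} w ≡ transitions s
  walk-of (i ∷ [])    = i , [] , refl
  walk-of (i ∷ j ∷ s) = let l , w , eq = walk-of (j ∷ s) in l , i ∷ w , cong (_ ∷_) eq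

  length-transitions : ∀ {n} (s : Sequence k n) → length (transitions s) ≡ n
  length-transitions (i ∷ [])    = refl
  length-transitions (i ∷ j ∷ s) = cong suc (length-transitions (j ∷ s))

  periodic : ∀ {u i l : Fin k} (a : Walk i u) (c : Walk u u) (b : Walk u l) {q r} n → Simple c → q ℕ.≤ r →
             size (a ⧺ (power c r ⧺ b)) ≡ n → PeriodicInterior q (sequence (a ⧺ (power c r ⧺ b)) n)
  -- A simple cycle is not empty; exposing its first edge makes the period visibly nonzero.
  periodic a c@(_ ∷ _) b {q} {r} n simple q≤r sz = record
    { p = length (sources c)
    ; p≤k = Unique-length-≤ (proj₁ simple)
    ; cycle = List.lookup (sources c)
    ; distinct = lookup-injective (proj₁ simple)
    ; start = size a
    ; len = q ℕ.* length (sources c)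
    ; long-enough = ℕ.≤-refl
    ; fits = fits
    ; runs-around = runs-around
    }
    where
    W = a ⧺ (power c r ⧺ b)
    p = length (sources c)
    %-cong : ∀ {i m n} .{{_ : NonZero m}} .{{_ : NonZero n}} → m ≡ n → i % m ≡ i % n
    %-cong refl = refl
    size-power : ∀ r → size (power c r) ≡ r ℕ.* size c
    size-power zero    = refl
    size-power (suc r) = trans (size-⧺ c (power c r)) (cong (size c ℕ.+_) (size-power r))
    q*p≤ : q ℕ.* p ℕ.≤ r ℕ.* size c
    q*p≤ = subst (λ p → q ℕ.* p ℕ.≤ r ℕ.* size c) (size-sources c) (ℕ.*-monoˡ-≤ (size c) q≤r)
    fits : size a ℕ.+ q ℕ.* p ℕ.≤ n
    fits = begin
      size a ℕ.+ q ℕ.* p                       ≤⟨ ℕ.+-monoʳ-≤ (size a) (ℕ.≤-trans q*p≤ (ℕ.m≤m+n _ (size b))) ⟩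
      size a ℕ.+ (r ℕ.* size c ℕ.+ size b)     ≡⟨ cong (λ x → size a ℕ.+ (x ℕ.+ size b)) (size-power r) ⟨
      size a ℕ.+ (size (power c r) ℕ.+ size b) ≡⟨ cong (size a ℕ.+_) (size-⧺ (power c r) b) ⟨
      size a ℕ.+ size (power c r ⧺ b)          ≡⟨ size-⧺ a _ ⟨
      size W                                   ≡⟨ sz ⟩
      n                                        ∎
      where open ℕ.≤-Reasoning
    runs-around : ∀ i → i ℕ.≤ q ℕ.* p → (in-range : size a ℕ.+ i ℕ.< suc n) →
                  lookup (sequence W n) (fromℕ< in-range) ≡ List.lookup (sources c) (i mod p)
    runs-around i i≤ in-range = begin
      lookup (sequence W n) (fromℕ< in-range)    ≡⟨ Vec.lookup∘tabulate (λ x → at W (toℕ x)) (fromℕ< in-range) ⟩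
      at W (toℕ (fromℕ< in-range))               ≡⟨ cong (at W) (Fin.toℕ-fromℕ< in-range) ⟩
      at W (size a ℕ.+ i)                        ≡⟨ at-right a _ i ⟩
      at (power c r ⧺ b) i                       ≡⟨ at-power c b r i (ℕ.≤-trans i≤ q*p≤) ⟩
      at c (i % size c)                          ≡⟨ cong (at c) (%-cong {i} (size-sources c)) ⟩
      at c (i % p)                               ≡⟨ cong (at c) (Fin.toℕ-fromℕ< (m%n<n i p)) ⟨
      at c (toℕ (i mod p))                       ≡⟨ at-source c (i mod p) ⟩
      List.lookup (sources c) (i mod p)          ∎
      where open ≡-Reasoning

-- A lower bound for the probability of Viterbi paths

some-large : ∀ {a b} → a ℚ.< b → ∀ {n} (f : Fin n → ℝ) → (∃[ i ] fromℚ a ⊑ f i) ⊎ (∀ i → f i ⊑ fromℚ b)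
some-large a<b {zero}  f = inj₂ λ ()
some-large {a} {b} a<b {suc n} f = by-cases (cotransitive a<b (f zero)) (some-large a<b (λ i → f (suc i)))
  where
  by-cases : f zero ⊑ fromℚ b ⊎ fromℚ a ⊑ f zero →
             (∃[ i ] fromℚ a ⊑ f (suc i)) ⊎ (∀ i → f (suc i) ⊑ fromℚ b) →
             (∃[ i ] fromℚ a ⊑ f i) ⊎ (∀ i → f i ⊑ fromℚ b)
  by-cases (inj₂ a≤) _               = inj₁ (zero , a≤)
  by-cases (inj₁ _)  (inj₁ (i , a≤)) = inj₁ (suc i , a≤)
  by-cases (inj₁ ≤b) (inj₂ all≤b)    = inj₂ λ { zero → ≤b ; (suc i) → all≤b i }

-- With `r = 1 / (k + 1)`, not all `k` probabilities can be at most `r`, since they sum to 1. The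
-- bound obtained is `r / 2` because the search for a large one relies on `cotransitive`.
likely-state : ∀ k → ∃[ a ] 0ℚ ℚ.< a × (∀ (d : Distribution k) → ∃[ i ] fromℚ a ⊑ prob d i)
likely-state k = r ℚ.* ½ , 0<* 0<r 0<½ , λ d → by-cases d (some-large r/2<r (prob d))
  where
  open +-*-Solver
  inverse : ∃[ r ] 0ℚ ℚ.< r × ν (suc k) ℚ.* r ≡ 1ℚ
  inverse = reciprocal (0<ν k)
  r : ℚ
  r = proj₁ inverse
  0<r : 0ℚ ℚ.< r
  0<r = proj₁ (proj₂ inverse)
  r/2<r : r ℚ.* ½ ℚ.< r
  r/2<r = subst₂ ℚ._<_ (ℚ.+-identityʳ _) (halves r) (ℚ.+-monoʳ-< (r ℚ.* ½) (0<* 0<r 0<½))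
  regroup : ∀ k r → r ℚ.+ k ℚ.* r ≡ 0ℚ ℚ.+ (1ℚ ℚ.+ k) ℚ.* r
  regroup = solve 2 (λ k r → r :+ k :* r := con 0ℚ :+ (con 1ℚ :+ k) :* r) refl
  by-cases : ∀ d → (∃[ i ] fromℚ (r ℚ.* ½) ⊑ prob d i) ⊎ (∀ i → prob d i ⊑ fromℚ r) → ∃[ i ] fromℚ (r ℚ.* ½) ⊑ prob d i
  by-cases d (inj₁ found) = found
  by-cases d (inj₂ small) = ⊥-elim (ℚ.<-irrefl refl (ℚ.<-≤-trans 0<r (≤-from r 0ℚ 1≤kr
    (trans (regroup (ν k) r) (cong (0ℚ ℚ.+_) (proj₂ (proj₂ inverse)))))))
    where
    1≤kr : 1ℚ ℚ.≤ ν k ℚ.* r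
    1≤kr = fromℚ-cancel (≤ˢ-trans (1≤Σprob d) (≤ˢ-trans (Σℝ-mono (prob d) (λ _ → fromℚ r) small)
      (≤ˢ-reflexive (λ n → trans (seq-Σℝ {k} (λ _ → fromℚ r) n) (sum-const k r)))))

seq-Pr : ∀ {k n} (M : Chain k) (s : Sequence k n) t →
  seq (Pr[ M ] s) t ≡ seq (prob (initial M) (head s)) t ℚ.* ∏ (λ e → seq (weight M e) t) (transitions s)
seq-Pr M s t = cong (seq (prob (initial M) (head s)) t ℚ.*_) (fold (transitions s))
  where
  fold : ∀ es → seq (List.foldr (λ (i , j) r → prob (transition M i) j *ℝ r) 1ℝ es) t ≡ ∏ (λ e → seq (weight M e) t) es
  fold []       = refl
  fold (e ∷ es) = cong (seq (weight M e) t ℚ.*_) (fold es)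

-- From each state a likely transition is followed. The bound depends on `k` and `n` only, and a
-- Viterbi path is at least as probable.
likely-path : ∀ k n → ∃[ ρ ] 0ℚ ℚ.< ρ × (∀ (M : Chain k) → Σ[ s ∈ Sequence k n ] fromℚ ρ ⊑ Pr[ M ] s)
likely-path k n = a ^ suc n , 0<^ (suc n) 0<a , λ M →
  let i , a≤   = proj₂ (proj₂ (likely-state k)) (initial M)
      s , h , a^n≤ = from M n i
  in s , ≤ˢ-trans (*ℝ-mono (fromℚ a) (prob (initial M) i) (fromℚ (a ^ n)) (∏ℝ (weight M) (transitions s))
                     (fromℚ-mono (ℚ.<⇒≤ 0<a)) (0⊑∏ℝ (weight M) (transitions s) (0≤weight M)) a≤ a^n≤)
           (≤ˢ-reflexive (λ t → trans (cong₂ ℚ._*_ (cong (λ i → seq (prob (initial M) i) t) (sym h))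
                                                   (seq-∏ℝ (weight M) (transitions s) t))
                                      (sym (seq-Pr M s t))))
  where
  a = proj₁ (likely-state k)
  0<a = proj₁ (proj₂ (likely-state k))
  from : ∀ M n i → ∃[ s ] head {n = n} s ≡ i × fromℚ (a ^ n) ⊑ ∏ℝ (weight M) (transitions {k} {n} s)
  from M zero    i = i ∷ [] , refl , ≤ˢ-refl
  from M (suc n) i with proj₂ (proj₂ (likely-state k)) (transition M i)
  ... | j , a≤ with from M n j
  ...   | j ∷ s , refl , a^n≤ = i ∷ j ∷ s , refl ,
    *ℝ-mono (fromℚ a) (prob (transition M i) j) (fromℚ (a ^ n)) (∏ℝ (weight M) (transitions (j ∷ s)))
      (fromℚ-mono (ℚ.<⇒≤ 0<a)) (0⊑∏ℝ (weight M) (transitions (j ∷ s)) (0≤weight M)) a≤ a^n≤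

-- Probabilities after an exchange of cycles

∏ℝ-weight≤1 : ∀ {k} (M : Chain k) es → ∏ℝ (weight M) es ⊑ 1ℝ
∏ℝ-weight≤1 M es = ≤ˢ-trans
  (∏ℝ-mono (weight M) (λ _ → 1ℝ) es (0≤weight M) (λ _ → fromℚ-mono 0≤1) (λ e _ → prob≤1 (transition M (proj₁ e)) (proj₂ e)))
  (≤ˢ-reflexive (λ t → trans (∏ℝ-fromℚ (λ _ → 1ℚ) es t) (one es)))
  where
  one : ∀ {A : Set} (es : List A) → ∏ (λ _ → 1ℚ) es ≡ 1ℚ
  one []       = refl
  one (e ∷ es) = trans (ℚ.*-identityˡ _) (one es)

-- Gx² and Gy² are at most Gxy, so G(y - x)² ≤ 0.
no-gap : ∀ (G x y : ℝ) {ρ} → 0ℚ ℚ.< ρ → 0ℝ ⊑ G → 0ℝ ⊑ x → x ⊑ 1ℝ → y ⊑ 1ℝ →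
  fromℚ ρ ⊑ G *ℝ (x *ℝ y) → G *ℝ (x *ℝ x) ⊑ G *ℝ (x *ℝ y) → G *ℝ (y *ℝ y) ⊑ G *ℝ (x *ℝ y) →
  ∀ η → 0ℚ ℚ.< η → ¬ (x +ℝ fromℚ η ⊑ y)
no-gap G x y {ρ} 0<ρ 0≤G 0≤x x≤1 y≤1 ρ≤ xx≤ yy≤ η 0<η gap =
  ℚ.<-irrefl refl (ℚ.<-≤-trans (0<* 0<ρ (0<* 0<η 0<η)) (fromℚ-cancel (≤ˢ-trans
    (*ℝ-mono (fromℚ ρ) G (fromℚ η *ℝ fromℚ η) (d *ℝ d) (fromℚ-mono (ℚ.<⇒≤ 0<ρ)) (0⊑* d d 0≤d 0≤d) ρ≤G
      (*ℝ-mono (fromℚ η) d (fromℚ η) d 0≤η 0≤d η≤d η≤d))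
    (≤ˢ-from (≤ˢ-+-mono xx≤ yy≤) (λ n → square (seq G n) (seq x n) (seq y n))))))
  where
  open +-*-Solver
  d : ℝ
  d = y +ℝ -ℝ x
  square : ∀ G x y → G ℚ.* ((y ℚ.+ ℚ.- 1ℚ ℚ.* x) ℚ.* (y ℚ.+ ℚ.- 1ℚ ℚ.* x)) ℚ.+ (G ℚ.* (x ℚ.* y) ℚ.+ G ℚ.* (x ℚ.* y))
                     ≡ 0ℚ ℚ.+ (G ℚ.* (x ℚ.* x) ℚ.+ G ℚ.* (y ℚ.* y))
  square = solve 3 (λ G x y → G :* ((y :+ con (ℚ.- 1ℚ) :* x) :* (y :+ con (ℚ.- 1ℚ) :* x)) :+ (G :* (x :* y) :+ G :* (x :* y))
                     := con 0ℚ :+ (G :* (x :* x) :+ G :* (y :* y))) refl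
  difference : ∀ x y η → η ℚ.+ y ≡ (y ℚ.+ ℚ.- 1ℚ ℚ.* x) ℚ.+ (x ℚ.+ η)
  difference = solve 3 (λ x y η → η :+ y := (y :+ con (ℚ.- 1ℚ) :* x) :+ (x :+ η)) refl
  0≤η : 0ℝ ⊑ fromℚ η
  0≤η = fromℚ-mono (ℚ.<⇒≤ 0<η)
  η≤d : fromℚ η ⊑ d
  η≤d = ≤ˢ-from gap (λ n → difference (seq x n) (seq y n) η)
  0≤d : 0ℝ ⊑ d
  0≤d = ≤ˢ-trans 0≤η η≤d
  ρ≤G : fromℚ ρ ⊑ G
  ρ≤G = ≤ˢ-trans ρ≤ (≤ˢ-trans
    (*ℝ-monoˡ G (x *ℝ y) (1ℝ *ℝ 1ℝ) 0≤G (*ℝ-mono x 1ℝ y 1ℝ 0≤x (fromℚ-mono 0≤1) x≤1 y≤1))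
    (≤ˢ-reflexive (λ n → ℚ.*-identityʳ (seq G n))))

-- `F` is the common part of the two cycles. With `G = π f² r`, the probabilities of `s`, `t₁` and
-- `t₂` are `G e₁ e₂`, `G e₁²` and `G e₂²`, so `no-gap` applies both ways.
exchange-indistinct : ∀ {k n} (M : Chain k) (s t₁ t₂ : Sequence k n) E₁ E₂ F R →
  IsViterbiPath M s → head t₁ ≡ head s → head t₂ ≡ head s →
  transitions s  ↭ (F ++ E₁) ++ (F ++ E₂) ++ R →
  transitions t₁ ↭ (F ++ E₁) ++ (F ++ E₁) ++ R →
  transitions t₂ ↭ (F ++ E₂) ++ (F ++ E₂) ++ R →
  Indistinct E₁ E₂ M
exchange-indistinct {k} {n} M s t₁ t₂ E₁ E₂ F R viterbi head₁ head₂ s↭ t₁↭ t₂↭ =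
  no-gap G e₁ e₂ 0<ρ 0≤G (nonneg E₁) (∏ℝ-weight≤1 M E₁) (∏ℝ-weight≤1 M E₂)
    (≤ˢ-trans ρ≤s s≤) (≤ˢ-trans ≤t₁ (≤ˢ-trans (≤ˢ-intro (viterbi t₁)) s≤)) (≤ˢ-trans ≤t₂ (≤ˢ-trans (≤ˢ-intro (viterbi t₂)) s≤)) ,
  no-gap G e₂ e₁ 0<ρ 0≤G (nonneg E₂) (∏ℝ-weight≤1 M E₂) (∏ℝ-weight≤1 M E₁)
    (≤ˢ-trans ρ≤s s≤′) (≤ˢ-trans ≤t₂ (≤ˢ-trans (≤ˢ-intro (viterbi t₂)) s≤′)) (≤ˢ-trans ≤t₁ (≤ˢ-trans (≤ˢ-intro (viterbi t₁)) s≤′))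
  where
  open +-*-Solver
  π e₁ e₂ f r G : ℝ
  π  = prob (initial M) (head s)
  e₁ = ∏ℝ (weight M) E₁
  e₂ = ∏ℝ (weight M) E₂
  f  = ∏ℝ (weight M) F
  r  = ∏ℝ (weight M) R
  G  = (π *ℝ (f *ℝ f)) *ℝ r
  nonneg : ∀ es → 0ℝ ⊑ ∏ℝ (weight M) es
  nonneg es = 0⊑∏ℝ (weight M) es (0≤weight M)
  0≤G : 0ℝ ⊑ G
  0≤G = 0⊑* (π *ℝ (f *ℝ f)) r (0⊑* π (f *ℝ f) (0≤prob (initial M) (head s)) (0⊑* f f (nonneg F) (nonneg F))) (nonneg R)
  ρ : ℚ
  ρ = proj₁ (likely-path k n)
  0<ρ : 0ℚ ℚ.< ρ
  0<ρ = proj₁ (proj₂ (likely-path k n))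
  ρ≤s : fromℚ ρ ⊑ Pr[ M ] s
  ρ≤s = let t , ρ≤t = proj₂ (proj₂ (likely-path k n)) M in ≤ˢ-trans ρ≤t (≤ˢ-intro (viterbi t))
  regroup : ∀ π f a b r → π ℚ.* ((f ℚ.* a) ℚ.* ((f ℚ.* b) ℚ.* r)) ≡ ((π ℚ.* (f ℚ.* f)) ℚ.* r) ℚ.* (a ℚ.* b)
  regroup = solve 5 (λ π f a b r → π :* ((f :* a) :* ((f :* b) :* r)) := ((π :* (f :* f)) :* r) :* (a :* b)) refl
  value : ∀ (t : Sequence k n) A B → head t ≡ head s → transitions t ↭ (F ++ A) ++ (F ++ B) ++ R → ∀ τ →
          seq (Pr[ M ] t) τ ≡ seq (G *ℝ (∏ℝ (weight M) A *ℝ ∏ℝ (weight M) B)) τ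
  value t A B head≡ t↭ τ = begin
    seq (Pr[ M ] t) τ
      ≡⟨ seq-Pr M t τ ⟩
    seq (prob (initial M) (head t)) τ ℚ.* ∏ w (transitions t)
      ≡⟨ cong₂ ℚ._*_ (cong (λ i → seq (prob (initial M) i) τ) head≡) (∏-↭ w t↭) ⟩
    seq π τ ℚ.* ∏ w ((F ++ A) ++ (F ++ B) ++ R)
      ≡⟨ cong (seq π τ ℚ.*_) (trans (∏-++ w (F ++ A) ((F ++ B) ++ R)) (cong₂ ℚ._*_ (∏-++ w F A)
           (trans (∏-++ w (F ++ B) R) (cong (ℚ._* ∏ w R) (∏-++ w F B))))) ⟩
    seq π τ ℚ.* ((∏ w F ℚ.* ∏ w A) ℚ.* ((∏ w F ℚ.* ∏ w B) ℚ.* ∏ w R))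
      ≡⟨ regroup (seq π τ) (∏ w F) (∏ w A) (∏ w B) (∏ w R) ⟩
    ((seq π τ ℚ.* (∏ w F ℚ.* ∏ w F)) ℚ.* ∏ w R) ℚ.* (∏ w A ℚ.* ∏ w B)
      ≡⟨ cong₂ ℚ._*_ (cong₂ (λ f r → (seq π τ ℚ.* (f ℚ.* f)) ℚ.* r) (W F) (W R)) (cong₂ ℚ._*_ (W A) (W B)) ⟨
    seq (G *ℝ (∏ℝ (weight M) A *ℝ ∏ℝ (weight M) B)) τ ∎
    where
    open ≡-Reasoning
    w : Edge k → ℚ
    w e = seq (weight M e) τ
    W : ∀ es → seq (∏ℝ (weight M) es) τ ≡ ∏ w es
    W es = seq-∏ℝ (weight M) es τ
  s≤ : Pr[ M ] s ⊑ G *ℝ (e₁ *ℝ e₂)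
  s≤ = ≤ˢ-reflexive (value s E₁ E₂ refl s↭)
  s≤′ : Pr[ M ] s ⊑ G *ℝ (e₂ *ℝ e₁)
  s≤′ = ≤ˢ-trans s≤ (≤ˢ-reflexive (λ τ → cong (seq G τ ℚ.*_) (ℚ.*-comm (seq e₁ τ) (seq e₂ τ))))
  ≤t₁ : G *ℝ (e₁ *ℝ e₁) ⊑ Pr[ M ] t₁
  ≤t₁ = ≤ˢ-reflexive (λ τ → sym (value t₁ E₁ E₁ head₁ t₁↭ τ))
  ≤t₂ : G *ℝ (e₂ *ℝ e₂) ⊑ Pr[ M ] t₂
  ≤t₂ = ≤ˢ-reflexive (λ τ → sym (value t₂ E₂ E₂ head₂ t₂↭ τ))

-- Two simple cycles with different edges

module _ {k : ℕ} where

  Functional : List (Edge k) → Set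
  Functional es = ∀ {i j j′} → (i , j) ∈ es → (i , j′) ∈ es → j ≡ j′

  distinct-sources⇒Functional : ∀ es → Unique (List.map proj₁ es) → Functional es
  distinct-sources⇒Functional (_ ∷ es) (e∉ ∷ u) (here refl) (here refl) = refl
  distinct-sources⇒Functional (_ ∷ es) (e∉ ∷ u) (here refl) (there e′∈) =
    ⊥-elim (All.lookup (All.map⁻ e∉) e′∈ refl)
  distinct-sources⇒Functional (_ ∷ es) (e∉ ∷ u) (there e∈)  (here refl) =
    ⊥-elim (All.lookup (All.map⁻ e∉) e∈ refl)
  distinct-sources⇒Functional (_ ∷ es) (e∉ ∷ u) (there e∈)  (there e′∈) = distinct-sources⇒Functional es u e∈ e′∈

  distinct-sources⇒Unique : ∀ {es : List (Edge k)} → Unique (List.map proj₁ es) → Unique es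
  distinct-sources⇒Unique u = AllPairs.map (λ ≢ eq → ≢ (cong proj₁ eq)) (AllPairs.map⁻ u)

  target : List (Edge k) → Fin k → Maybe (Fin k)
  target []             i = nothing
  target ((a , b) ∷ es) i with a Fin.≟ i
  ... | yes _ = just b
  ... | no  _ = target es i

  target-sound : ∀ es {i j} → target es i ≡ just j → (i , j) ∈ es
  target-sound ((a , b) ∷ es) {i} eq with a Fin.≟ i
  target-sound ((a , b) ∷ es) refl | yes refl = here refl
  ... | no  _    = there (target-sound es eq)

  target-complete : ∀ es {i j} → (i , j) ∈ es → ∃[ j′ ] target es i ≡ just j′
  target-complete ((a , b) ∷ es) {i} e∈ with a Fin.≟ i
  ... | yes _ = b , refl
  target-complete ((a , b) ∷ es) (here refl) | no a≢a = ⊥-elim (a≢a refl)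
  target-complete ((a , b) ∷ es) (there e∈)  | no _   = target-complete es e∈

  target-≡ : ∀ es → Functional es → ∀ {i j} → (i , j) ∈ es → target es i ≡ just j
  target-≡ es fun e∈ = let j′ , eq = target-complete es e∈ in trans eq (cong just (fun (target-sound es eq) e∈))

other : ∀ {κ} → Fin (suc (suc κ)) → Fin (suc (suc κ))
other zero    = suc zero
other (suc _) = zero

other-≢ : ∀ {κ} (i : Fin (suc (suc κ))) → i ≢ other i
other-≢ zero    ()
other-≢ (suc i) ()

-- In a row with edges from both lists, mass moves from the second target to the first. In a row
-- with one edge only, an arbitrary other state gives or takes the mass.
combine : ∀ {κ} → let k = suc (suc κ) in Maybe (Fin k) → Maybe (Fin k) → Maybe (Fin k × Fin k)
combine (just a) (just b) = just (a , b)
combine (just a) nothing  = just (a , other a)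
combine nothing  (just b) = just (other b , b)
combine nothing  nothing  = nothing

direction : ∀ {κ} → List (Edge (suc (suc κ))) → List (Edge (suc (suc κ))) → Direction (suc (suc κ))
direction E₁ E₂ i = combine (target E₁ i) (target E₂ i)

module _ {κ : ℕ} (E₁ E₂ : List (Edge (suc (suc κ)))) (fun₁ : Functional E₁) (fun₂ : Functional E₂)
  (disjoint : ∀ {e} → e ∈ E₁ → e ∈ E₂ → ⊥) where

  direction-up : ∀ {i j} → (i , j) ∈ E₁ → ∃[ β ] direction E₁ E₂ i ≡ just (j , β) × j ≢ β
  direction-up {i} {j} e∈ with target E₂ i in eq₂
  ... | just b  = b , cong (λ x → combine x (just b)) (target-≡ E₁ fun₁ e∈) ,
                  λ { refl → disjoint e∈ (target-sound E₂ eq₂) }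
  ... | nothing = other j , cong (λ x → combine x nothing) (target-≡ E₁ fun₁ e∈) , other-≢ j

  direction-down : ∀ {i j} → (i , j) ∈ E₂ → ∃[ α ] direction E₁ E₂ i ≡ just (α , j) × α ≢ j
  direction-down {i} {j} e∈ with target E₁ i in eq₁
  ... | just a  = a , cong (combine (just a)) (target-≡ E₂ fun₂ e∈) ,
                  λ { refl → disjoint (target-sound E₁ eq₁) e∈ }
  ... | nothing = other j , cong (combine nothing) (target-≡ E₂ fun₂ e∈) , other-≢ j ∘ sym

  velocity-up : ∀ e → e ∈ E₁ → velocity (direction E₁ E₂) (proj₁ e) (proj₂ e) ≡ 1ℚ
  velocity-up e e∈ = let _ , eq , ≢ = direction-up e∈ in velocity-gain (direction E₁ E₂) eq ≢

  velocity-down : ∀ e → e ∈ E₂ → velocity (direction E₁ E₂) (proj₁ e) (proj₂ e) ≡ ℚ.- 1ℚ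
  velocity-down e e∈ = let _ , eq , ≢ = direction-down e∈ in velocity-loss (direction E₁ E₂) eq ≢

  -- State 0 has no coordinate of its own. If the edge leads there, the state that gives up its mass
  -- differs from 0 and serves as pivot.
  free-coordinate : ∀ e → e ∈ E₁ → ∃[ j ] (velocity (direction E₁ E₂) (proj₁ e) (suc j) ≡ 1ℚ
                                       ⊎ velocity (direction E₁ E₂) (proj₁ e) (suc j) ≡ ℚ.- 1ℚ)
  free-coordinate (i , suc j) e∈ = j , inj₁ (velocity-up (i , suc j) e∈)
  free-coordinate (i , zero)  e∈ with direction-up e∈
  ... | zero  , eq , ≢ = ⊥-elim (≢ refl)
  ... | suc j , eq , ≢ = j , inj₂ (velocity-loss (direction E₁ E₂) eq ≢)

-- Cycles of equal length in a Viterbi sequence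

module _ {k : ℕ} where

  open DecMembership (Product.≡-dec (Fin._≟_ {k}) (Fin._≟_ {k})) using (_∈?_)

  _∩_ _∖_ : List (Edge k) → List (Edge k) → List (Edge k)
  xs ∩ ys = List.filter (_∈? ys) xs
  xs ∖ ys = List.filter (¬? ∘ (_∈? ys)) xs

  ∩-∖-↭ : ∀ xs ys → xs ↭ (xs ∩ ys) ++ (xs ∖ ys)
  ∩-∖-↭ xs ys = filter-↭-partition (_∈? ys) xs

  -- Lists without repetitions that have the same members are permutations of each other. This
  -- provides one common part for both cycles.
  ∩-comm-↭ : ∀ {xs ys} → Unique xs → Unique ys → xs ∩ ys ↭ ys ∩ xs
  ∩-comm-↭ {xs} {ys} ux uy = ∼bag⇒↭ (unique∧set⇒bag (Unique.filter⁺ (_∈? ys) ux) (Unique.filter⁺ (_∈? xs) uy)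
    (mk⇔ (flip xs ys) (flip ys xs)))
    where
    flip : ∀ xs ys {e} → e ∈ xs ∩ ys → e ∈ ys ∩ xs
    flip xs ys e∈ = let e∈xs , e∈ys = ∈-filter⁻ (_∈? ys) {xs = xs} e∈ in ∈-filter⁺ (_∈? xs) e∈ys e∈xs

  ∖-⊆ : ∀ xs ys {e} → e ∈ xs ∖ ys → e ∈ xs
  ∖-⊆ xs ys e∈ = proj₁ (∈-filter⁻ (¬? ∘ (_∈? ys)) {xs = xs} e∈)

  ∖-disjoint : ∀ xs ys {e} → e ∈ xs ∖ ys → e ∈ ys ∖ xs → ⊥
  ∖-disjoint xs ys e∈ e∈′ = proj₂ (∈-filter⁻ (¬? ∘ (_∈? ys)) {xs = xs} e∈) (∖-⊆ ys xs e∈′)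

  loop-sources : ∀ {l q i} (B : Beads {k} l q i) x → Unique (List.map proj₁ (loop B x))
  loop-sources B x = subst Unique (sources-edges (Located.cycle L)) (proj₁ (Located.simple L))
    where L = locate B x

  Exchangeable : ∀ {n} → Sequence k n → List (Edge k) → List (Edge k) → Set
  Exchangeable {n} s C D = ∃[ R ] ∃[ t₁ ] ∃[ t₂ ] head {n = n} t₁ ≡ head s × head {n = n} t₂ ≡ head s ×
    transitions s ↭ C ++ D ++ R × transitions t₁ ↭ C ++ C ++ R × transitions t₂ ↭ D ++ D ++ R

  -- The two sequences traverse the beads `x` and `y` twice and never, or never and twice. Equal
  -- lengths of the loops keep the total length at `n`.
  beads-exchangeable : ∀ {n l q} (s : Sequence k n) (B : Beads l q (head s)) →
    edges (thread B (ones q)) ≡ transitions s → ∀ {x y} → x ≢ y → length (loop B x) ≡ length (loop B y) →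
    Exchangeable s (loop B x) (loop B y)
  beads-exchangeable {n} {l} {q} s B eq {x} {y} x≢y len≡ =
    R , sequence w₁ n , sequence w₂ n , at-start w₁ , at-start w₂ , s↭ ,
    ↭-trans (↭-reflexive (transitions-sequence w₁ size₁)) ↭₁ ,
    ↭-trans (↭-reflexive (transitions-sequence w₂ size₂)) ↭₂
    where
    C = loop B x
    D = loop B y
    R = edges (thread B ((ones q [ x ]≔ 0) [ y ]≔ 0))
    w₁ = thread B ((ones q [ x ]≔ 2) [ y ]≔ 0)
    w₂ = thread B ((ones q [ x ]≔ 0) [ y ]≔ 2)
    same : ones q ≡ (ones q [ x ]≔ 1) [ y ]≔ 1
    same = sym (trans (cong (_[ y ]≔ 1) (unchanged x)) (unchanged y))
      where
      unchanged : ∀ z → ones q [ z ]≔ 1 ≡ ones q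
      unchanged z = trans (cong (ones q [ z ]≔_) (sym (Vec.lookup-replicate z 1))) (Vec.[]≔-lookup (ones q) z)
    twice : ∀ es → repeat 2 es ++ R ≡ es ++ es ++ R
    twice es = trans (List.++-assoc es (es ++ []) R) (cong (λ z → es ++ z ++ R) (List.++-identityʳ es))
    s↭ : transitions s ↭ C ++ D ++ R
    s↭ = ↭-trans (↭-reflexive (trans (sym eq) (cong (edges ∘ thread B) same)))
      (↭-trans (thread-update₂ B (ones q) x≢y 1 1)
        (↭-reflexive (cong₂ (λ C D → C ++ D ++ R) (List.++-identityʳ C) (List.++-identityʳ D))))
    ↭₁ : edges w₁ ↭ C ++ C ++ R
    ↭₁ = ↭-trans (thread-update₂ B (ones q) x≢y 2 0) (↭-reflexive (twice C))
    ↭₂ : edges w₂ ↭ D ++ D ++ R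
    ↭₂ = ↭-trans (thread-update₂ B (ones q) x≢y 0 2) (↭-reflexive (twice D))
    same-length : ∀ xs ys → length xs ≡ length C → length ys ≡ length C → length (xs ++ ys ++ R) ≡ n
    same-length xs ys xs≡ ys≡ = begin
      length (xs ++ ys ++ R)                    ≡⟨ lengths xs ys ⟩
      length xs ℕ.+ (length ys ℕ.+ length R)    ≡⟨ cong₂ (λ a b → a ℕ.+ (b ℕ.+ length R)) xs≡ (trans ys≡ len≡) ⟩
      length C ℕ.+ (length D ℕ.+ length R)      ≡⟨ lengths C D ⟨
      length (C ++ D ++ R)                      ≡⟨ Perm.↭-length s↭ ⟨
      length (transitions s)                    ≡⟨ length-transitions s ⟩
      n                                         ∎
      where
      open ≡-Reasoning
      lengths : ∀ xs ys → length (xs ++ ys ++ R) ≡ length xs ℕ.+ (length ys ℕ.+ length R)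
      lengths xs ys = trans (List.length-++ xs) (cong (length xs ℕ.+_) (List.length-++ ys))
    size₁ : size w₁ ≡ n
    size₁ = trans (Perm.↭-length ↭₁) (same-length C C refl refl)
    size₂ : size w₂ ≡ n
    size₂ = trans (Perm.↭-length ↭₂) (same-length D D (sym len≡) (sym len≡))

-- For one state there is only one edge, so equal length suffices. For more states the two
-- differences have equal length; if they are not both empty, their products are indistinct
-- throughout the region, which then has covers of arbitrarily small volume.
exchangeable-↭ : ∀ {k n} (s : Sequence k n) → IsViterbiSequence s → ∀ {C D} →
  Unique (List.map proj₁ C) → Unique (List.map proj₁ D) → length C ≡ length D → Exchangeable s C D → C ↭ D
exchangeable-↭ {zero} s@(() ∷ _) vs uC uD len≡ ex
exchangeable-↭ {suc zero} s vs {C} {D} uC uD len≡ ex = ↭-reflexive (single C D len≡)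
  where
  single : ∀ (xs ys : List (Edge 1)) → length xs ≡ length ys → xs ≡ ys
  single []                   []                   eq = refl
  single ((zero , zero) ∷ xs) ((zero , zero) ∷ ys) eq = cong (_ ∷_) (single xs ys (ℕ.suc-injective eq))
exchangeable-↭ {suc (suc κ)} {n} s (M₀ , (ε , 0<ε , uncoverable) , viterbi) {C} {D} uC uD len≡
  (R , t₁ , t₂ , head₁ , head₂ , s↭ , t₁↭ , t₂↭) = by-cases (C ∖ D) (D ∖ C) refl refl
  where
  F = C ∩ D
  C↭ : C ↭ F ++ (C ∖ D)
  C↭ = ∩-∖-↭ C D
  D↭ : D ↭ F ++ (D ∖ C)
  D↭ = ↭-trans (∩-∖-↭ D C) (Perm.++⁺ʳ (D ∖ C) (∩-comm-↭ (distinct-sources⇒Unique uD) (distinct-sources⇒Unique uC)))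
  refine : ∀ {X Y X′ Y′ : List (Edge (suc (suc κ)))} → X ↭ X′ → Y ↭ Y′ → X ++ Y ++ R ↭ X′ ++ Y′ ++ R
  refine X↭ Y↭ = Perm.++⁺ X↭ (Perm.++⁺ʳ R Y↭)
  indistinct : ∀ M → SameRegion n M₀ M → Indistinct (C ∖ D) (D ∖ C) M
  indistinct M same = exchange-indistinct M s t₁ t₂ (C ∖ D) (D ∖ C) F R
    (Equivalence.to (same s) viterbi) head₁ head₂
    (↭-trans s↭ (refine C↭ D↭)) (↭-trans t₁↭ (refine C↭ C↭)) (↭-trans t₂↭ (refine D↭ D↭))
  length-∖ : length (C ∖ D) ≡ length (D ∖ C)
  length-∖ = ℕ.+-cancelˡ-≡ (length F) _ _ (begin
    length F ℕ.+ length (C ∖ D)  ≡⟨ List.length-++ F ⟨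
    length (F ++ (C ∖ D))        ≡⟨ Perm.↭-length C↭ ⟨
    length C                     ≡⟨ len≡ ⟩
    length D                     ≡⟨ Perm.↭-length D↭ ⟩
    length (F ++ (D ∖ C))        ≡⟨ List.length-++ F ⟩
    length F ℕ.+ length (D ∖ C)  ∎)
    where open ≡-Reasoning
  functional : ∀ {X Y} → Unique (List.map proj₁ X) → Functional (X ∖ Y)
  functional {X} {Y} u e∈ e′∈ = distinct-sources⇒Functional X u (∖-⊆ X Y e∈) (∖-⊆ X Y e′∈)
  by-cases : ∀ E₁ E₂ → C ∖ D ≡ E₁ → D ∖ C ≡ E₂ → C ↭ D
  by-cases [] [] eq₁ eq₂ = ↭-trans C↭ (↭-trans (↭-reflexive (cong (F ++_) (trans eq₁ (sym eq₂)))) (↭-sym D↭))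
  by-cases [] (_ ∷ _) eq₁ eq₂ with trans (sym (cong length eq₁)) (trans length-∖ (cong length eq₂))
  ... | ()
  by-cases (_ ∷ _) [] eq₁ eq₂ with trans (sym (cong length eq₁)) (trans length-∖ (cong length eq₂))
  ... | ()
  by-cases E₁@(x₁ ∷ X₁) E₂@(x₂ ∷ X₂) eq₁ eq₂ =
    let fun₁ = subst Functional eq₁ (functional uC)
        fun₂ = subst Functional eq₂ (functional uD)
        disjoint = λ {e} (e∈ : e ∈ E₁) (e∈′ : e ∈ E₂) → ∖-disjoint C D (subst (e ∈_) (sym eq₁) e∈) (subst (e ∈_) (sym eq₂) e∈′)
        j , pivot = free-coordinate E₁ E₂ fun₁ fun₂ disjoint x₁ (here refl)
        c , covers , small = nullset (direction E₁ E₂) x₁ X₁ x₂ X₂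
          (velocity-up E₁ E₂ fun₁ fun₂ disjoint) (velocity-down E₁ E₂ fun₁ fun₂ disjoint) (proj₁ x₁) j pivot 0<ε
    in ⊥-elim (uncoverable c (λ M same → covers M (subst₂ (λ E F → Indistinct E F M) eq₁ eq₂ (indistinct M same))) small)

-- Gathering cycles with the same edges into one place

proposition3p2 : (k m : ℕ) → 1 ≤ k → 1 ≤ m →
    (S : Sequence k (k * (m * k + 1))) → IsViterbiSequence S →
    ∃[ S′ ] (Equivalent S S′ × PeriodicInterior (m + 1) S′)
proposition3p2 k m _ _ S viterbi = answer
  where
  q n : ℕ
  q = m ℕ.* k ℕ.+ 1
  n = k ℕ.* q
  walk = walk-of S
  w = proj₁ (proj₂ walk)
  size-w : size w ≡ n
  size-w = trans (cong length (proj₂ (proj₂ walk))) (length-transitions S)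
  strung = string q w (ℕ.≤-reflexive (trans (ℕ.*-comm q k) (sym size-w)))
  B = proj₁ strung
  B≡S : edges (thread B (ones q)) ≡ transitions S
  B≡S = trans (proj₂ strung) (proj₂ (proj₂ walk))
  -- Cycle lengths run from 1 to `k`; lowered by 1 they are the `k` values below `k` for the
  -- pigeonhole principle.
  len : Fin q → ℕ
  len x = ℕ.pred (length (loop B x))
  suc-len : ∀ x → suc (len x) ≡ length (loop B x)
  suc-len x = ℕ.suc-pred _ {{ℕ.>-nonZero (proj₂ (Located.simple (locate B x)))}}
  len< : ∀ x → len x ℕ.< k
  len< x = subst (ℕ._≤ k) (sym (suc-len x)) (size-simple {c = Located.cycle (locate B x)} (Located.simple (locate B x)))
  crowded : ∃[ p ] m ℕ.< length (List.filter (λ x → len x ℕ.≟ p) (List.allFin q))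
  crowded = pigeonhole len k m (List.allFin q) (All.tabulate (λ {x} _ → len< x))
    (subst (m ℕ.* k ℕ.<_) (sym (List.length-tabulate (λ x → x))) (subst (m ℕ.* k ℕ.<_) (ℕ.+-comm 1 (m ℕ.* k)) ℕ.≤-refl))
  answer : ∃[ S′ ] (Equivalent S S′ × PeriodicInterior (m ℕ.+ 1) S′)
  answer = from (List.filter (λ x → len x ℕ.≟ proj₁ crowded) (List.allFin q)) (proj₂ crowded)
      (All.all-filter (λ x → len x ℕ.≟ proj₁ crowded) (List.allFin q))
      (Unique.filter⁺ (λ x → len x ℕ.≟ proj₁ crowded) (Unique.allFin⁺ q))
    where
    from : ∀ xs → m ℕ.< length xs → All (λ x → len x ≡ proj₁ crowded) xs → Unique xs →
           ∃[ S′ ] (Equivalent S S′ × PeriodicInterior (m ℕ.+ 1) S′)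
    from (x ∷ ys) (ℕ.s≤s m≤) (len-x ∷ len-ys) (x∉ ∷ uniq) =
      -- Bead `x` takes over the traversals of at least `m` others and keeps its own, which makes at
      -- least `m + 1` periods.
      let ns , count , S↭ = gather B x ys (ones q) uniq x∉
            (All.zipWith (λ { {y} (x≢y , len-y) → loop-↭ (x≢y ∘ sym) (trans len-y (sym len-x)) }) (x∉ , len-ys))
            (All.tabulate (λ {y} _ → Vec.lookup-replicate y 1))
          located c simple around = locate B x
          a , b , eq = around ns
          W = a ⧺ (power c (lookup ns x) ⧺ b)
          S↭W = ↭-trans (↭-reflexive (sym B≡S)) (↭-trans S↭ (↭-reflexive (cong edges eq)))
          size-W = trans (sym (Perm.↭-length S↭W)) (length-transitions S)
          m+1≤ = subst (m ℕ.+ 1 ℕ.≤_) (sym (trans count (cong (length ys ℕ.+_) (Vec.lookup-replicate x 1)))) (ℕ.+-monoˡ-≤ 1 m≤)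
      in sequence W n
       , (sym (at-start W) , ↭-trans S↭W (↭-reflexive (sym (transitions-sequence W size-W))))
       , periodic a c b n simple m+1≤ size-W
      where
      loop-↭ : ∀ {y} → y ≢ x → len y ≡ len x → loop B y ↭ loop B x
      loop-↭ {y} y≢x len≡ = exchangeable-↭ S viterbi (loop-sources B y) (loop-sources B x) length≡
        (beads-exchangeable S B B≡S y≢x length≡)
        where
        length≡ : length (loop B y) ≡ length (loop B x)
        length≡ = trans (sym (suc-len y)) (trans (cong suc len≡) (suc-len x))
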